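{- For all constants $c$ and all $d>0$, any (possibly randomized) non-adaptive algorithm for PARTITION with query complexity $dn$ necessarily has expected $c$-weighted error $\Omega((n/d)^{c+1})$ in the noiseless model, $\Omega((n/(d\gamma))^{c+1})$ in the erasure model, and $\Omega((n/(d\gamma^2))^{c+1})$ in the noisy model.
   Context: Setting. The input is a set of $n$ elements with an unknown total order, presented in uniformly random order (the elements are a priori indistinguishable). For $i\in\{1,\dots,n\}$ the $i$-th smallest element is denoted $i$. PARTITION (with cutoff the median, $k=n/2$): output a partition of the elements into a set $A$ (accepted, meant to be the elements above the median) and a set $R$ (rejected, meant to be the elements below the median). For a constant $c\ge 0$, the $c$-weighted error of $A\sqcup R$ is $\sum_{i>n/2} I(i\in R)\,|i-n/2|^c+\sum_{i<n/2} I(i\in A)\,|i-n/2|^c$, where $I$ is the indicator function (so $c=0$ counts mistakes). Algorithms access the order only through pairwise comparison queries; the same pair may be queried several times. Query complexity is the total number of comparisons. Non-adaptive means round complexity $1$: all queries are chosen before any answer is seen. Noiseless model: every comparison returns the correct answer. Erasure model with parameter $\gamma$: each comparison independently returns the correct answer with probability $\gamma$ and the symbol $\bot$ with probability $1-\gamma$. Noisy model with parameter $\gamma$: each comparison independently returns the correct answer with probability $1/2+\gamma/2$ and the incorrect answer with probability $1/2-\gamma/2$. Asymptotics are as $n\to\infty$; hidden constants may depend on $c$. Expectations are over the random input order, the comparison outcomes and the algorithm's randomness.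
   Formalization: The hidden constant depends on c and on a lower bound d₀ for d (resp. dγ, dγ²), since no constant depending on c alone works as d → 0 (the error is at most n(n/2)^c); the bound is stated for n at least a constant times d (resp. dγ, dγ²). -}

module Defs where

open import Algebra.Bundles using (CommutativeRing)
open import Algebra.Structures using (IsCommutativeRing)
open import Data.Bool using (Bool; true; false)
open import Data.Fin using (Fin; toℕ)
import Data.Fin.Properties as Finₚ
open import Data.List using (List; []; _∷_; length; map; foldr; filter; allFin; cartesianProductWith)
open import Data.Maybe using (Maybe; just; nothing)
open import Data.Nat using (ℕ; zero; suc; NonZero; ∣_-_∣)
import Data.Nat as ℕ
import Data.Nat.Properties as ℕₚ
open import Data.Product using (∃-syntax; _×_)
open import Data.Vec using (Vec; []; _∷_; lookup)
import Data.Vec as Vec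
open import Data.Vec.Relation.Unary.AllPairs using (allPairs?)
open import Level using (Level; _⊔_) renaming (suc to lsuc)
open import Relation.Binary.Core using (Rel)
open import Relation.Binary.Definitions using (Cotransitive)
open import Relation.Binary.PropositionalEquality using (_≢_; ≢-sym)
open import Relation.Binary.Structures using (IsStrictPartialOrder)
open import Relation.Nullary using (¬_; yes; no; does)
open import Relation.Nullary.Decidable using (¬?)
import Algebra.Definitions.RawMonoid as RawMonoidDefs

infix 3 _,⁺_

record Positive {a ℓ} {A : Set a} (_<_ : Rel A ℓ) (0# : A) : Set (a ⊔ ℓ) where
  constructor _,⁺_
  field
    val : A
    pos : 0# < val
open Positive public

-- The real numbers, axiomatised as an Archimedean, Cauchy-complete ordered
-- field.  The axioms are the constructive ones: x ≤ y is ¬ (y < x), the strict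
-- order is cotransitive rather than trichotomous, and only numbers known to be
-- positive are inverted.  With excluded middle the first three groups of
-- fields are exactly the usual axioms of a complete ordered field.

record Reals (a ℓ₁ ℓ₂ : Level) : Set (lsuc (a ⊔ ℓ₁ ⊔ ℓ₂)) where
  infix  4 _≈_ _<_ _≤_
  infixl 6 _+_ _-_
  infixl 7 _*_
  infix  8 -_
  field
    ℝ                 : Set a
    _≈_               : Rel ℝ ℓ₁
    _<_               : Rel ℝ ℓ₂
    _+_ _*_           : ℝ → ℝ → ℝ
    -_                : ℝ → ℝ
    0# 1#             : ℝ
    isCommutativeRing : IsCommutativeRing _≈_ _+_ _*_ -_ 0# 1#

  commutativeRing : CommutativeRing a ℓ₁
  commutativeRing = record { isCommutativeRing = isCommutativeRing }

  open RawMonoidDefs (CommutativeRing.+-rawMonoid commutativeRing) public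
    using (sum) renaming (_×_ to _·_)

  _≤_ : Rel ℝ ℓ₂
  x ≤ y = ¬ (y < x)

  _-_ : ℝ → ℝ → ℝ
  x - y = x + (- y)

  fromℕ : ℕ → ℝ
  fromℕ n = n · 1#

  ℝ⁺ : Set (a ⊔ ℓ₂)
  ℝ⁺ = Positive _<_ 0#

  field
    isStrictPartialOrder : IsStrictPartialOrder _≈_ _<_
    <-cotrans            : Cotransitive _<_
    ≤-antisym            : ∀ {x y} → x ≤ y → y ≤ x → x ≈ y
    0<1                  : 0# < 1#
    +-monoˡ-<            : ∀ {x y} z → x < y → x + z < y + z
    *-pos                : ∀ {x y} → 0# < x → 0# < y → 0# < x * y
    _⁻¹                  : ℝ⁺ → ℝ⁺
    *-inverseʳ           : ∀ x → val x * val (x ⁻¹) ≈ 1#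

  infixl 7 _*⁺_ _/⁺_

  _*⁺_ : ℝ⁺ → ℝ⁺ → ℝ⁺
  x *⁺ y = val x * val y ,⁺ *-pos (pos x) (pos y)

  field
    archimedean : ∀ x → ∃[ n ] x < fromℕ n
    complete    : (s : ℕ → ℝ) →
                  (∀ (ε : ℝ⁺) → ∃[ N ] (∀ m n → N ℕ.≤ m → N ℕ.≤ n → s m - s n < val ε)) →
                  ∃[ l ] (∀ (ε : ℝ⁺) → ∃[ N ] (∀ n → N ℕ.≤ n → (s n - l < val ε) × (l - s n < val ε)))

  -- Real powers of positive reals.  These laws determine the function: for
  -- x ≥ 1 it is the only monotone homomorphism a ↦ x ^ a from (ℝ, +) to
  -- (ℝ⁺, *) with x ^ 1 ≈ x, and ^-distrib-* extends this to x < 1.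
  infixr 9 _^_
  field
    _^_         : ℝ⁺ → ℝ → ℝ⁺
    ^-cong      : ∀ {x y a b} → val x ≈ val y → a ≈ b → val (x ^ a) ≈ val (y ^ b)
    ^-identityʳ : ∀ x → val (x ^ 1#) ≈ val x
    ^-homo-+    : ∀ x a b → val (x ^ (a + b)) ≈ val (x ^ a) * val (x ^ b)
    ^-distrib-* : ∀ x y a → val ((x *⁺ y) ^ a) ≈ val (x ^ a) * val (y ^ a)
    ^-monoʳ-≤   : ∀ x {a b} → 1# ≤ val x → a ≤ b → val (x ^ a) ≤ val (x ^ b)

  _/⁺_ : ℝ⁺ → ℝ⁺ → ℝ⁺
  x /⁺ y = x *⁺ (y ⁻¹)

  private
    module ring = CommutativeRing commutativeRing
    module <    = IsStrictPartialOrder isStrictPartialOrder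

  fromℕ-pos : ∀ n → 0# < fromℕ (suc n)
  fromℕ-pos zero    = <.<-respʳ-≈ (ring.sym (ring.+-identityʳ 1#)) 0<1
  fromℕ-pos (suc n) = <.trans (fromℕ-pos n)
    (<.<-respˡ-≈ (ring.+-identityˡ _) (+-monoˡ-< (fromℕ (suc n)) 0<1))

  fromℕ⁺ : (n : ℕ) .{{_ : NonZero n}} → ℝ⁺
  fromℕ⁺ (suc n) = fromℕ (suc n) ,⁺ fromℕ-pos n

  ½ : ℝ⁺
  ½ = fromℕ⁺ 2 ⁻¹


allVecs : {A : Set} → List A → (m : ℕ) → List (Vec A m)
allVecs xs zero    = [] ∷ []
allVecs xs (suc m) = cartesianProductWith _∷_ xs (allVecs xs m)

-- A vector π : Vec (Fin n) n with distinct entries is an order on the elements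
-- Fin n: lookup π x is the 0-based rank of x.
permutations : (n : ℕ) → List (Vec (Fin n) n)
permutations n = filter (allPairs? (λ i j → ¬? (i Finₚ.≟ j))) (allVecs (allFin n) n)

rank : ∀ {n} → Vec (Fin n) n → Fin n → ℕ
rank π x = suc (toℕ (lookup π x))

data Side : Set where
  accept reject : Side

record Query (n : ℕ) : Set where
  field
    left right : Fin n
    distinct   : left ≢ right

-- Whether the left element is the smaller one.
correctAnswer : ∀ {n} → Vec (Fin n) n → Query n → Bool
correctAnswer π q = does (rank π (Query.left q) ℕ.<? rank π (Query.right q))

-- The queries do not depend on the answers.
record NonAdaptive (Answer : Set) (n : ℕ) : Set where
  field
    numQueries : ℕ
    queries    : Vec (Query n) numQueries
    decide     : Vec Answer numQueries → Fin n → Side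


module Partition {a ℓ₁ ℓ₂} (R : Reals a ℓ₁ ℓ₂) where
  open Reals R

  sumOver : {A : Set} → List A → (A → ℝ) → ℝ
  sumOver xs f = foldr _+_ 0# (map f xs)

  mean : {A : Set} → List A → (A → ℝ) → ℝ
  mean []       f = 0#
  mean (x ∷ xs) f = val (fromℕ⁺ (suc (length xs)) ⁻¹) * sumOver (x ∷ xs) f

  -- outcomes lists every answer once; likelihood b is the distribution of the
  -- answer to a comparison whose correct answer is b.
  record Model : Set (lsuc Level.zero ⊔ a) where
    field
      Answer     : Set
      outcomes   : List Answer
      likelihood : Bool → Answer → ℝ
  open Model public

  ifCorrect : Bool → Bool → ℝ → ℝ → ℝ
  ifCorrect true  true  p q = p
  ifCorrect false false p q = p
  ifCorrect true  false p q = q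
  ifCorrect false true  p q = q

  noiseless : Model
  noiseless = record
    { Answer     = Bool
    ; outcomes   = true ∷ false ∷ []
    ; likelihood = λ b ans → ifCorrect b ans 1# 0#
    }

  -- nothing is the symbol ⊥.
  erasure : ℝ → Model
  erasure γ = record
    { Answer     = Maybe Bool
    ; outcomes   = just true ∷ just false ∷ nothing ∷ []
    ; likelihood = λ { b (just ans) → ifCorrect b ans γ 0#
                     ; b nothing    → 1# - γ }
    }

  noisy : ℝ → Model
  noisy γ = record
    { Answer     = Bool
    ; outcomes   = true ∷ false ∷ []
    ; likelihood = λ b ans → ifCorrect b ans (val ½ + val ½ * γ) (val ½ - val ½ * γ)
    }

  -- For a given n there are only finitely many non-adaptive algorithms within
  -- a query budget, so finitely supported randomness is fully general.
  record Randomized (Answer : Set) (n : ℕ) : Set (a ⊔ ℓ₁ ⊔ ℓ₂) where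
    field
      numSeeds    : ℕ
      probability : Fin numSeeds → ℝ
      nonNegative : ∀ s → 0# ≤ probability s
      total       : sum probability ≈ 1#
      run         : Fin numSeeds → NonAdaptive Answer n

    QueryComplexity≤ : ℝ → Set ℓ₂
    QueryComplexity≤ q = ∀ s → fromℕ (NonAdaptive.numQueries (run s)) ≤ q
  open Randomized public

  -- |i - n/2|, computed as |2i - n| / 2.
  distance : (n i : ℕ) → 2 ℕ.* i ≢ n → ℝ⁺
  distance n i 2i≢n = fromℕ⁺ ∣ 2 ℕ.* i - n ∣ {{nonZero}} *⁺ ½
    where
    nonZero : NonZero ∣ 2 ℕ.* i - n ∣
    nonZero = ℕ.≢-nonZero (λ eq → 2i≢n (ℕₚ.∣m-n∣≡0⇒m≡n eq))

  errorOf : (c : ℝ) (n i : ℕ) → Side → ℝ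
  errorOf c n i reject with n ℕ.<? 2 ℕ.* i
  ... | yes n<2i = val (distance n i (≢-sym (ℕₚ.<⇒≢ n<2i)) ^ c)
  ... | no  _    = 0#
  errorOf c n i accept with 2 ℕ.* i ℕ.<? n
  ... | yes 2i<n = val (distance n i (ℕₚ.<⇒≢ 2i<n) ^ c)
  ... | no  _    = 0#

  weightedError : ∀ {n} → ℝ → Vec (Fin n) n → (Fin n → Side) → ℝ
  weightedError {n} c π side = sum (λ x → errorOf c n (rank π x) (side x))

  -- Expectation over independent answers to comparisons with the given correct
  -- answers.
  expectAnswers : (M : Model) → ∀ {m} → Vec Bool m → (Vec (Answer M) m → ℝ) → ℝ
  expectAnswers M []       f = f []
  expectAnswers M (b ∷ bs) f =
    sumOver (outcomes M) λ ans → likelihood M b ans * expectAnswers M bs (λ as → f (ans ∷ as))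

  expectedError : (M : Model) → ∀ {n} → ℝ → Randomized (Answer M) n → ℝ
  expectedError M {n} c alg =
    sum λ s → probability alg s * (mean (permutations n) λ π →
      let open NonAdaptive (run alg s) in
      expectAnswers M (Vec.map (correctAnswer π) queries) λ as →
      weightedError c π (decide as))

  -- With at most d n queries the expected error is at least C (n/δ)^(c+1), once
  -- n is large enough that n ≥ K δ.  Here δ is the effective density d, d γ or
  -- d γ².  As the error never exceeds n (n/2)^c, no C serves all δ > 0 at once;
  -- C and K can only be uniform over δ ≥ d₀, for each fixed d₀ > 0.
  ErrorBound : (c : ℝ) (M : Model) (C K d δ : ℝ⁺) → Set (a ⊔ ℓ₁ ⊔ ℓ₂)
  ErrorBound c M C K d δ =
    ∀ (n : ℕ) .{{_ : NonZero n}} → val K * val δ ≤ fromℕ n →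
    ∀ (alg : Randomized (Answer M) n) → QueryComplexity≤ alg (val d * fromℕ n) →
    val C * val ((fromℕ⁺ n /⁺ δ) ^ (c + 1#)) ≤ expectedError M c alg

{-# OPTIONS --safe #-}

-- Let k queries change their correct answer when the elements of ranks lo and
-- hi, on either side of the median, exchange ranks.  Each answer distribution
-- has χ²-divergence η = 1, γ or γ² from a base distribution that does not depend
-- on the correct answer, so replacing the affected answers by the base
-- distribution costs (1 + η)ᵏ − 1 in χ², and the algorithm misplaces the element
-- of rank lo, before or after the exchange, with probability at least
-- (1 − 8kη)/4.  Under a random order a query is affected only if one of its
-- elements has rank lo or hi and the other a rank nearby, so 𝔼 k ≲ d n (hi − lo)/n²,
-- and η 𝔼 k is small as long as hi − lo ≲ n/(dη).  Summing over a ≈ n/(dη) such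
-- pairs of ranks, all at distance at least a from the median, gives an expected
-- error of order a ^ (c + 1).

module Submission where

open import Defs
open import Algebra.Bundles using (CommutativeMonoid; CommutativeRing; RawRing)
import Algebra.Properties.CommutativeMonoid.Sum as MonoidSum
import Algebra.Properties.CommutativeSemigroup as CommutativeSemigroupProperties
import Algebra.Properties.Ring as RingProperties
import Algebra.Properties.Semiring.Mult as SemiringMult
import Algebra.Properties.Semiring.Sum as SemiringSum
import Algebra.Solver.Ring as RingSolver
open import Algebra.Solver.Ring.AlmostCommutativeRing using (fromCommutativeSemiring; _-Raw-AlmostCommutative⟶_)
open import Data.Bool using (Bool; true; false; if_then_else_)
open import Data.Fin using (Fin; zero; suc; toℕ; fromℕ<; punchOut)
open import Data.Fin.Permutation using (Permutation′; transpose; _⟨$⟩ʳ_)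
import Data.Fin.Permutation as Perm
import Data.Fin.Properties as Finₚ
open import Data.List using (List; []; _∷_; _++_; length; map; foldr; filter; allFin; tabulate; cartesianProductWith)
open import Data.List.Membership.Propositional using (_∈_)
open import Data.List.Membership.Propositional.Properties using (∈-filter⁺; ∈-cartesianProductWith⁺; ∈-allFin)
import Data.List.Relation.Unary.All as Allᴸ
open import Data.List.Relation.Unary.All.Properties using (all-filter)
open import Data.List.Relation.Unary.Any using (here)
open import Data.Maybe using (Maybe; just; nothing)
import Data.Maybe as Maybe
open import Data.Nat using (ℕ; zero; suc; z≤n; s≤s; NonZero; ⌊_/2⌋; ⌈_/2⌉; ∣_-_∣)
import Data.Nat as ℕ
import Data.Nat.Properties as ℕₚ
open import Data.Nat.Solver using (module +-*-Solver)
open import Data.Product using (Σ-syntax; _×_; _,_; proj₁; proj₂; ∃-syntax)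
open import Data.Sum using ([_,_]′)
open import Data.Vec using (Vec; []; _∷_; lookup)
import Data.Vec as Vec
import Data.Vec.Properties as Vecₚ
open import Data.Vec.Relation.Unary.All using (All; []; _∷_)
open import Data.Vec.Relation.Unary.AllPairs using (allPairs?)
open import Data.Vec.Relation.Unary.Unique.Propositional using (Unique)
import Data.Vec.Relation.Unary.Unique.Propositional.Properties as Uniqueₚ
open import Function using (_∘_; id; Injective)
open import Level using (Level; _⊔_)
open import Relation.Binary.Bundles using (Preorder)
open import Relation.Binary.PropositionalEquality using (_≡_; _≢_)
import Relation.Binary.PropositionalEquality as ≡
import Relation.Binary.Reasoning.Preorder as PreorderReasoning
import Relation.Binary.Reasoning.Setoid as SetoidReasoning
open import Relation.Binary.Structures using (IsStrictPartialOrder)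
open import Relation.Nullary using (¬_; Dec; yes; no; does; contradiction)
open import Relation.Nullary.Decidable using (¬?; _×-dec_; dec-true; dec-false; dec⇒maybe)
open import Relation.Unary using (Pred; Decidable)

-- In the noiseless model the two answer distributions of a comparison are mutually singular, so
-- they have no finite divergence from each other. Comparing each with a base that dominates both
-- keeps everything finite and treats the three models alike: a model enters only through `η`. Both
-- orders of a pair are compared with one and the same reference measure, under which acceptance and
-- rejection of an element have total mass 1. A polynomial square is integrated in place of a
-- Cauchy-Schwarz estimate, so no square root appears. The number `k` of affected queries depends on
-- the random order; the two-point bound is therefore kept linear in `k` and valid for every `k`,
-- and only the mean of `k` is needed. The exchange acts on ranks and permutes the orders, hence
-- preserves the uniform law; it turns a statement about two elements in one order into one about a
-- single element in two orders. Inequalities between reals are negations, so case distinctions and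
-- integer parts may be used classically.

module Combinatorics where
  open import Data.Nat using (_+_; _*_; _≤_; _<_; _<?_; _≤?_)
  open ≡ using (refl; sym; trans; cong; cong₂; subst; ≢-sym; module ≡-Reasoning)

  -- Orders as vectors of distinct ranks.

  distinct? : ∀ {m n} → Decidable {A = Vec (Fin n) m} Unique
  distinct? = allPairs? (λ i j → ¬? (i Finₚ.≟ j))

  permutations-distinct : ∀ n → Allᴸ.All Unique (permutations n)
  permutations-distinct n = all-filter distinct? (allVecs (allFin n) n)

  ∈-allVecs : ∀ {A : Set} {xs : List A} {m} (v : Vec A m) → (∀ i → lookup v i ∈ xs) → v ∈ allVecs xs m
  ∈-allVecs []      v⊆xs = here refl
  ∈-allVecs (x ∷ v) v⊆xs = ∈-cartesianProductWith⁺ _∷_ (v⊆xs zero) (∈-allVecs v (v⊆xs ∘ suc))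

  -- Witnesses that the list of orders is nonempty, so that `mean` over it is a genuine average and
  -- not its default value `0#`.
  identity∈permutations : ∀ n → Vec.tabulate id ∈ permutations n
  identity∈permutations n = ∈-filter⁺ distinct? (∈-allVecs _ (λ _ → ∈-allFin _)) (Uniqueₚ.tabulate⁺ id)

  -- Supplies the element that has a given rank. If `i` were missed, punching it out would embed
  -- `Fin (suc n)` into `Fin n`.
  injective⇒surjective : ∀ {n} {f : Fin n → Fin n} → Injective _≡_ _≡_ f → ∀ i → ∃[ x ] f x ≡ i
  injective⇒surjective {suc n} {f} f-inj i with Finₚ.any? (λ x → f x Finₚ.≟ i)
  ... | yes hit  = hit
  ... | no  miss = contradiction (Finₚ.injective⇒≤ g-inj) ℕₚ.1+n≰n
    where
    i≢f : ∀ x → i ≢ f x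
    i≢f x eq = miss (x , sym eq)
    g-inj : Injective _≡_ _≡_ (λ x → punchOut (i≢f x))
    g-inj {x} {y} eq = f-inj (Finₚ.punchOut-injective (i≢f x) (i≢f y) eq)

  ⟨$⟩ʳ-injective : ∀ {n} (σ : Permutation′ n) → Injective _≡_ _≡_ (σ ⟨$⟩ʳ_)
  ⟨$⟩ʳ-injective σ {i} {j} eq = trans (sym (Perm.inverseˡ σ)) (trans (cong (σ Perm.⟨$⟩ˡ_) eq) (Perm.inverseˡ σ))

  -- Sums over lists, and the symmetry of a uniformly random order.

  module ListSum {a ℓ} (M : CommutativeMonoid a ℓ) where
    open CommutativeMonoid M renaming (refl to ≈-refl; sym to ≈-sym; trans to ≈-trans; reflexive to ≈-reflexive;
        ∙-congˡ to +-congˡ; ∙-cong to +-cong)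
    open MonoidSum M using (sum; sum-permute; sum-replicate-zero; ∑-distrib-+)
    open CommutativeSemigroupProperties commutativeSemigroup using (interchange)
    open SetoidReasoning setoid

    ∑ᴸ : {A : Set} → List A → (A → Carrier) → Carrier
    ∑ᴸ xs f = foldr _∙_ ε (map f xs)

    ∑ᴸ-cong : ∀ {A : Set} (xs : List A) {f g : A → Carrier} → (∀ x → f x ≈ g x) → ∑ᴸ xs f ≈ ∑ᴸ xs g
    ∑ᴸ-cong []       f≈g = ≈-refl
    ∑ᴸ-cong (x ∷ xs) f≈g = +-cong (f≈g x) (∑ᴸ-cong xs f≈g)

    ∑ᴸ-++ : ∀ {A : Set} (xs ys : List A) f → ∑ᴸ (xs ++ ys) f ≈ ∑ᴸ xs f ∙ ∑ᴸ ys f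
    ∑ᴸ-++ []       ys f = ≈-sym (identityˡ _)
    ∑ᴸ-++ (x ∷ xs) ys f = ≈-trans (+-congˡ (∑ᴸ-++ xs ys f)) (≈-sym (assoc _ _ _))

    ∑ᴸ-map : ∀ {A B : Set} (xs : List A) (g : A → B) f → ∑ᴸ (map g xs) f ≈ ∑ᴸ xs (f ∘ g)
    ∑ᴸ-map []       g f = ≈-refl
    ∑ᴸ-map (x ∷ xs) g f = +-congˡ (∑ᴸ-map xs g f)

    ∑ᴸ-cartesianProductWith : ∀ {A B C : Set} (g : A → B → C) xs ys f →
      ∑ᴸ (cartesianProductWith g xs ys) f ≈ ∑ᴸ xs (λ x → ∑ᴸ ys (f ∘ g x))
    ∑ᴸ-cartesianProductWith g []       ys f = ≈-refl
    ∑ᴸ-cartesianProductWith g (x ∷ xs) ys f = ≈-trans (∑ᴸ-++ (map (g x) ys) _ f)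
      (+-cong (∑ᴸ-map ys (g x) f) (∑ᴸ-cartesianProductWith g xs ys f))

    ∑ᴸ-filter : ∀ {A : Set} {p} {P : Pred A p} (P? : Decidable P) xs f →
      ∑ᴸ (filter P? xs) f ≈ ∑ᴸ xs (λ x → if does (P? x) then f x else ε)
    ∑ᴸ-filter P? []       f = ≈-refl
    ∑ᴸ-filter P? (x ∷ xs) f with does (P? x)
    ... | true  = +-congˡ (∑ᴸ-filter P? xs f)
    ... | false = ≈-trans (∑ᴸ-filter P? xs f) (≈-sym (identityˡ _))

    ∑ᴸ-tabulate : ∀ {A : Set} {n} (g : Fin n → A) f → ∑ᴸ (tabulate g) f ≈ sum (f ∘ g)
    ∑ᴸ-tabulate {n = zero}  g f = ≈-refl
    ∑ᴸ-tabulate {n = suc n} g f = +-congˡ (∑ᴸ-tabulate (g ∘ suc) f)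

    ∑ᴸ-distrib-∙ : ∀ {A : Set} (xs : List A) f g → ∑ᴸ xs (λ x → f x ∙ g x) ≈ ∑ᴸ xs f ∙ ∑ᴸ xs g
    ∑ᴸ-distrib-∙ []       f g = ≈-sym (identityˡ _)
    ∑ᴸ-distrib-∙ (x ∷ xs) f g = ≈-trans (+-congˡ (∑ᴸ-distrib-∙ xs f g)) (interchange _ _ _ _)

    ∑ᴸ-sum-comm : ∀ {A : Set} {n} (xs : List A) (f : A → Fin n → Carrier) →
      ∑ᴸ xs (λ x → sum (f x)) ≈ sum (λ i → ∑ᴸ xs (λ x → f x i))
    ∑ᴸ-sum-comm {n = n} []       f = ≈-sym (sum-replicate-zero n)
    ∑ᴸ-sum-comm         (x ∷ xs) f = ≈-trans (+-congˡ (∑ᴸ-sum-comm xs f))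
        (≈-sym (∑-distrib-+ (f x) (λ i → ∑ᴸ xs (λ x → f x i))))

    allFin-invariant : ∀ {n} (σ : Permutation′ n) f → ∑ᴸ (allFin n) f ≈ ∑ᴸ (allFin n) (f ∘ (σ ⟨$⟩ʳ_))
    allFin-invariant {n} σ f = begin
      ∑ᴸ (allFin n) f                ≈⟨ ∑ᴸ-tabulate id f ⟩
      sum f                          ≈⟨ sum-permute f σ ⟩
      sum (f ∘ (σ ⟨$⟩ʳ_))            ≈⟨ ∑ᴸ-tabulate id (f ∘ (σ ⟨$⟩ʳ_)) ⟨
      ∑ᴸ (allFin n) (f ∘ (σ ⟨$⟩ʳ_))  ∎

    allVecs-invariant : ∀ {A : Set} {xs : List A} (g : A → A) → (∀ f → ∑ᴸ xs f ≈ ∑ᴸ xs (f ∘ g)) →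
      ∀ m f → ∑ᴸ (allVecs xs m) f ≈ ∑ᴸ (allVecs xs m) (f ∘ Vec.map g)
    allVecs-invariant          g inv zero    f = ≈-refl
    allVecs-invariant {xs = xs} g inv (suc m) f = begin
      ∑ᴸ (allVecs xs (suc m)) f
        ≈⟨ ∑ᴸ-cartesianProductWith _∷_ xs _ f ⟩
      ∑ᴸ xs (λ x → ∑ᴸ (allVecs xs m) (λ v → f (x ∷ v)))
        ≈⟨ inv _ ⟩
      ∑ᴸ xs (λ x → ∑ᴸ (allVecs xs m) (λ v → f (g x ∷ v)))
        ≈⟨ ∑ᴸ-cong xs (λ x → allVecs-invariant g inv m _) ⟩
      ∑ᴸ xs (λ x → ∑ᴸ (allVecs xs m) (λ v → f (g x ∷ Vec.map g v)))
        ≈⟨ ∑ᴸ-cartesianProductWith _∷_ xs _ _ ⟨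
      ∑ᴸ (allVecs xs (suc m)) (f ∘ Vec.map g)  ∎

    -- Relabelling the ranks acts on all vectors one coordinate at a time and neither creates nor
    -- destroys repetitions, so the uniform law on orders is preserved. Needed over `ℕ` for counting
    -- and over `ℝ` for expectations.
    permutations-invariant : ∀ {n} (σ : Permutation′ n) f →
      ∑ᴸ (permutations n) f ≈ ∑ᴸ (permutations n) (f ∘ Vec.map (σ ⟨$⟩ʳ_))
    permutations-invariant {n} σ f = begin
      ∑ᴸ (permutations n) f
        ≈⟨ ∑ᴸ-filter distinct? (allVecs _ n) f ⟩
      ∑ᴸ (allVecs _ n) (λ v → if does (distinct? v) then f v else ε)
        ≈⟨ allVecs-invariant (σ ⟨$⟩ʳ_) (allFin-invariant σ) n _ ⟩
      ∑ᴸ (allVecs _ n) (λ v → if does (distinct? (Vec.map (σ ⟨$⟩ʳ_) v)) then f (Vec.map (σ ⟨$⟩ʳ_) v) else ε)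
        ≈⟨ ∑ᴸ-cong (allVecs _ n) (λ v → ≈-reflexive (cong (λ b → if b then f (Vec.map (σ ⟨$⟩ʳ_) v) else ε) (same v))) ⟩
      ∑ᴸ (allVecs _ n) (λ v → if does (distinct? v) then f (Vec.map (σ ⟨$⟩ʳ_) v) else ε)
        ≈⟨ ∑ᴸ-filter distinct? (allVecs _ n) _ ⟨
      ∑ᴸ (permutations n) (f ∘ Vec.map (σ ⟨$⟩ʳ_))  ∎
      where
      from-map : ∀ v → Unique (Vec.map (σ ⟨$⟩ʳ_) v) → Unique v
      from-map v uniq = subst Unique (trans (sym (Vecₚ.map-∘ _ _ v))
        (trans (Vecₚ.map-cong (λ _ → Perm.inverseˡ σ) v) (Vecₚ.map-id v)))
        (Uniqueₚ.map⁺ (⟨$⟩ʳ-injective (Perm.flip σ)) uniq)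
      same : ∀ v → does (distinct? (Vec.map (σ ⟨$⟩ʳ_) v)) ≡ does (distinct? v)
      same v with distinct? v
      ... | yes u = dec-true (distinct? _) (Uniqueₚ.map⁺ (⟨$⟩ʳ-injective σ) u)
      ... | no ¬u = dec-false (distinct? _) (¬u ∘ from-map v)

  -- Indicators, transpositions and counting.

  ind : ∀ {p} {P : Set p} → Dec P → ℕ
  ind P? = if does P? then 1 else 0

  δ : ∀ {n} → Fin n → Fin n → ℕ
  δ i j = ind (i Finₚ.≟ j)

  ind-yes : ∀ {p} {P : Set p} (P? : Dec P) → P → ind P? ≡ 1
  ind-yes P? p rewrite dec-true P? p = refl

  ind-no : ∀ {p} {P : Set p} (P? : Dec P) → ¬ P → ind P? ≡ 0
  ind-no P? ¬p rewrite dec-false P? ¬p = refl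

  ind-mono : ∀ {p q} {P : Set p} {Q : Set q} (P? : Dec P) (Q? : Dec Q) → (P → Q) → ind P? ≤ ind Q?
  ind-mono (yes p) Q? P⇒Q = ℕₚ.≤-reflexive (sym (ind-yes Q? (P⇒Q p)))
  ind-mono (no _)  Q? P⇒Q = z≤n

  δ-injective : ∀ {m n} {f : Fin m → Fin n} → Injective _≡_ _≡_ f → ∀ i j → δ (f i) (f j) ≡ δ i j
  δ-injective {f = f} f-inj i j = ℕₚ.≤-antisym
    (ind-mono (f i Finₚ.≟ f j) (i Finₚ.≟ j) f-inj) (ind-mono (i Finₚ.≟ j) (f i Finₚ.≟ f j) (cong f))

  transpose-left : ∀ {n} (i j : Fin n) → transpose i j ⟨$⟩ʳ i ≡ j
  transpose-left i j rewrite dec-true (i Finₚ.≟ i) refl = refl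

  transpose-right : ∀ {n} (i j : Fin n) → transpose i j ⟨$⟩ʳ j ≡ i
  transpose-right i j with j Finₚ.≟ i
  ... | yes j≡i = j≡i
  ... | no  _ rewrite dec-true (j Finₚ.≟ j) refl = refl

  transpose-other : ∀ {n} (i j : Fin n) {k} → k ≢ i → k ≢ j → transpose i j ⟨$⟩ʳ k ≡ k
  transpose-other i j {k} k≢i k≢j rewrite dec-false (k Finₚ.≟ i) k≢i | dec-false (k Finₚ.≟ j) k≢j = refl

  module ∑ℕ where
    open SemiringSum ℕₚ.+-*-semiring public using (sum; sum-cong-≗; sum-replicate-zero; *-distribˡ-sum; ∑-distrib-+)
    open ListSum ℕₚ.+-0-commutativeMonoid public

    sum-mono : ∀ {n} (f g : Fin n → ℕ) → (∀ i → f i ≤ g i) → sum f ≤ sum g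
    sum-mono {zero}  f g f≤g = z≤n
    sum-mono {suc n} f g f≤g = ℕₚ.+-mono-≤ (f≤g zero) (sum-mono (f ∘ suc) (g ∘ suc) (f≤g ∘ suc))

    sum-zero : ∀ {n} (f : Fin n → ℕ) → (∀ i → f i ≡ 0) → sum f ≡ 0
    sum-zero {n} f f≡0 = trans (sum-cong-≗ f≡0) (sum-replicate-zero n)

    sum-const : ∀ n c → sum {n} (λ _ → c) ≡ n * c
    sum-const zero    c = refl
    sum-const (suc n) c = cong (c +_) (sum-const n c)

    ∑ᴸ-mono : ∀ {A : Set} (xs : List A) {f g : A → ℕ} → (∀ x → f x ≤ g x) → ∑ᴸ xs f ≤ ∑ᴸ xs g
    ∑ᴸ-mono []       f≤g = z≤n
    ∑ᴸ-mono (x ∷ xs) f≤g = ℕₚ.+-mono-≤ (f≤g x) (∑ᴸ-mono xs f≤g)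

    ∑ᴸ-one : ∀ {A : Set} (xs : List A) → ∑ᴸ xs (λ _ → 1) ≡ length xs
    ∑ᴸ-one []       = refl
    ∑ᴸ-one (x ∷ xs) = cong suc (∑ᴸ-one xs)

    *-distribʳ-∑ᴸ : ∀ {A : Set} (xs : List A) c f → ∑ᴸ xs f * c ≡ ∑ᴸ xs (λ x → f x * c)
    *-distribʳ-∑ᴸ []       c f = refl
    *-distribʳ-∑ᴸ (x ∷ xs) c f = trans (ℕₚ.*-distribʳ-+ c (f x) _) (cong (f x * c +_) (*-distribʳ-∑ᴸ xs c f))

    sum-δ : ∀ {n} (i : Fin n) (f : Fin n → ℕ) → sum (λ j → δ i j * f j) ≡ f i
    sum-δ {suc n} zero    f = trans (cong₂ _+_ (ℕₚ.+-identityʳ (f zero)) (sum-zero {n} _ (λ _ → refl)))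
        (ℕₚ.+-identityʳ (f zero))
    sum-δ {suc n} (suc i) f = trans (sum-cong-≗ {n}
        (λ j → cong (_* f (suc j)) (δ-injective Finₚ.suc-injective i j))) (sum-δ i (f ∘ suc))

    sum-δ-injective : ∀ {m n} {f : Fin m → Fin n} → Injective _≡_ _≡_ f → ∀ i → sum (λ j → δ (f j) i) ≤ 1
    sum-δ-injective {zero}          f-inj i = z≤n
    sum-δ-injective {suc m} {f = f} f-inj i with f zero Finₚ.≟ i
    ... | yes f0≡i = s≤s (ℕₚ.≤-reflexive (sum-zero (λ j → δ (f (suc j)) i) λ j →
                       ind-no (f (suc j) Finₚ.≟ i) (λ eq → Finₚ.0≢1+n (f-inj (trans f0≡i (sym eq))))))
    ... | no  _    = sum-δ-injective (Finₚ.suc-injective ∘ f-inj) i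

    inside? : ∀ {n} (p l : ℕ) (j : Fin n) → Dec (p ≤ toℕ j × toℕ j < p + l)
    inside? p l j = (p ≤? toℕ j) ×-dec (toℕ j <? p + l)

    -- Only an upper bound, because the interval may reach beyond `n`.
    sum-interval : ∀ n p l → sum {n} (ind ∘ inside? p l) ≤ l
    sum-interval zero    p       l       = z≤n
    sum-interval (suc n) zero    zero    = ℕₚ.≤-reflexive
        (sum-zero {suc n} (ind ∘ inside? 0 0) λ j → ind-no (inside? 0 0 j) λ ())
    sum-interval (suc n) zero    (suc l) = s≤s (ℕₚ.≤-trans
      (sum-mono {n} (ind ∘ inside? 0 (suc l) ∘ suc) (ind ∘ inside? 0 l) λ j → ind-mono (inside? 0 (suc l) (suc j))
          (inside? 0 l j) λ (_ , q) → z≤n , ℕₚ.≤-pred q)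
      (sum-interval n 0 l))
    sum-interval (suc n) (suc p) l       = ℕₚ.≤-trans
      (sum-mono {n} (ind ∘ inside? (suc p) l ∘ suc) (ind ∘ inside? p l) λ j → ind-mono (inside? (suc p) l (suc j))
          (inside? p l j) λ (q , r) → ℕₚ.≤-pred q , ℕₚ.≤-pred r)
      (sum-interval n p l)

  -- Joint law of the ranks of two elements in a random order.

  module _ {n : ℕ} where
    open ∑ℕ
    private
      P = permutations n

    module JointRanks (u v : Fin n) where
      marginal : Fin n → ℕ
      marginal i = ∑ᴸ P (λ π → δ (lookup π u) i)

      joint : Fin n → Fin n → ℕ
      joint i j = ∑ᴸ P (λ π → δ (lookup π u) i * δ (lookup π v) j)

      δ-relabel : ∀ (σ : Permutation′ n) (π : Vec (Fin n) n) x i →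
        δ (lookup (Vec.map (σ ⟨$⟩ʳ_) π) x) (σ ⟨$⟩ʳ i) ≡ δ (lookup π x) i
      δ-relabel σ π x i = trans (cong (λ k → δ k (σ ⟨$⟩ʳ i)) (Vecₚ.lookup-map x (σ ⟨$⟩ʳ_) π))
                                (δ-injective (⟨$⟩ʳ-injective σ) (lookup π x) i)

      marginal-relabel : ∀ (σ : Permutation′ n) i → marginal (σ ⟨$⟩ʳ i) ≡ marginal i
      marginal-relabel σ i = trans (permutations-invariant σ _) (∑ᴸ-cong P (λ π → δ-relabel σ π u i))

      joint-relabel : ∀ (σ : Permutation′ n) i j → joint (σ ⟨$⟩ʳ i) (σ ⟨$⟩ʳ j) ≡ joint i j
      joint-relabel σ i j = trans (permutations-invariant σ _)
        (∑ᴸ-cong P (λ π → cong₂ _*_ (δ-relabel σ π u i) (δ-relabel σ π v j)))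

      sum-marginal : sum marginal ≡ length P
      sum-marginal = begin
        sum marginal                             ≡⟨ ∑ᴸ-sum-comm P (λ π → δ (lookup π u)) ⟨
        ∑ᴸ P (λ π → sum (δ (lookup π u)))        ≡⟨ ∑ᴸ-cong P (λ π → trans
          (sum-cong-≗ {n} (λ i → sym (ℕₚ.*-identityʳ (δ (lookup π u) i)))) (sum-δ (lookup π u) (λ _ → 1))) ⟩
        ∑ᴸ P (λ _ → 1)                           ≡⟨ ∑ᴸ-one P ⟩
        length P                                 ∎
        where open ≡-Reasoning

      -- By symmetry alone: `transpose i k` carries rank `i` to rank `k`, so the `n` marginals agree
      -- and no factorial has to be computed.
      n*marginal : ∀ i → n * marginal i ≡ length P
      n*marginal i = begin
        n * marginal i                   ≡⟨ sum-const n (marginal i) ⟨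
        sum {n} (λ _ → marginal i)       ≡⟨ sum-cong-≗ {n} (λ k → trans (sym (marginal-relabel (transpose i k) i))
                                              (cong marginal (transpose-left i k))) ⟩
        sum marginal                     ≡⟨ sum-marginal ⟩
        length P                         ∎
        where open ≡-Reasoning

      sum-joint : ∀ i → sum (joint i) ≡ marginal i
      sum-joint i = trans (sym (∑ᴸ-sum-comm P (λ π j → δ (lookup π u) i * δ (lookup π v) j)))
        (∑ᴸ-cong P (λ π → trans (sum-cong-≗ {n} (λ j → ℕₚ.*-comm (δ (lookup π u) i) _))
          (sum-δ (lookup π v) (λ _ → δ (lookup π u) i))))

      -- The row `joint i` sums to `marginal i`, and its off-diagonal entries agree because
      -- `transpose j k` fixes `i`. This is `(n − 1) · joint ≤ marginal` without subtraction; the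
      -- extra `joint i j` makes up for the diagonal entry `k = i`.
      n*joint : ∀ {i j} → i ≢ j → n * joint i j ≤ marginal i + joint i j
      n*joint {i} {j} i≢j = begin
        n * joint i j                                      ≡⟨ sum-const n (joint i j) ⟨
        sum {n} (λ _ → joint i j)
          ≤⟨ sum-mono (λ _ → joint i j) (λ k → joint i k + δ i k * joint i j) pointwise ⟩
        sum (λ k → joint i k + δ i k * joint i j)          ≡⟨ ∑-distrib-+ (joint i) (λ k → δ i k * joint i j) ⟩
        sum (joint i) + sum (λ k → δ i k * joint i j)      ≡⟨ cong₂ _+_ (sum-joint i) (sum-δ i (λ _ → joint i j)) ⟩
        marginal i + joint i j                             ∎
        where
        open ℕₚ.≤-Reasoning
        pointwise : ∀ k → joint i j ≤ joint i k + δ i k * joint i j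
        pointwise k with i Finₚ.≟ k
        ... | yes _   = ℕₚ.≤-trans (ℕₚ.≤-reflexive (sym (ℕₚ.+-identityʳ _))) (ℕₚ.m≤n+m _ (joint i k))
        ... | no  i≢k = ℕₚ.≤-trans (ℕₚ.≤-reflexive (trans (sym (joint-relabel (transpose j k) i j))
                          (cong₂ joint (transpose-other j k i≢j i≢k) (transpose-left j k)))) (ℕₚ.m≤m+n _ _)

      -- As a probability, `1 / (n (n − 1)) ≤ 2 / n²`: the factor `2` absorbs `n / (n − 1)`.
      n²*joint : 2 ≤ n → ∀ {i j} → i ≢ j → n * n * joint i j ≤ 2 * length P
      n²*joint 2≤n {i} {j} i≢j = begin
        n * n * N                ≡⟨ ℕₚ.*-assoc n n N ⟩
        n * (n * N)              ≤⟨ nnN≤ ⟩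
        length P + n * N         ≤⟨ ℕₚ.+-monoʳ-≤ (length P) nN≤ ⟩
        length P + length P      ≡⟨ cong (length P +_) (ℕₚ.+-identityʳ _) ⟨
        2 * length P             ∎
        where
        open ℕₚ.≤-Reasoning
        N = joint i j
        nnN≤ : n * (n * N) ≤ length P + n * N
        nnN≤ = begin
          n * (n * N)                 ≤⟨ ℕₚ.*-monoʳ-≤ n (n*joint i≢j) ⟩
          n * (marginal i + N)        ≡⟨ ℕₚ.*-distribˡ-+ n (marginal i) N ⟩
          n * marginal i + n * N      ≡⟨ cong (_+ n * N) (n*marginal i) ⟩
          length P + n * N            ∎
        nN≤ : n * N ≤ length P
        nN≤ = ℕₚ.+-cancelʳ-≤ (n * N) (n * N) (length P) (begin
          n * N + n * N      ≡⟨ cong (n * N +_) (ℕₚ.+-identityʳ _) ⟨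
          2 * (n * N)        ≤⟨ ℕₚ.*-monoˡ-≤ (n * N) 2≤n ⟩
          n * (n * N)        ≤⟨ nnN≤ ⟩
          length P + n * N   ∎)

      -- `n²*joint` holds off the diagonal only, so `f` has to vanish at the rank `i` itself.
      n²*weighted : 2 ≤ n → ∀ {i} (f : Fin n → ℕ) → f i ≡ 0 →
        n * n * ∑ᴸ P (λ π → δ (lookup π u) i * f (lookup π v)) ≤ 2 * length P * sum f
      n²*weighted 2≤n {i} f fi≡0 = begin
        n * n * ∑ᴸ P (λ π → δ (lookup π u) i * f (lookup π v))
          ≡⟨ cong (n * n *_) (∑ᴸ-cong P expand) ⟩
        n * n * ∑ᴸ P (λ π → sum (λ j → δ (lookup π u) i * δ (lookup π v) j * f j))
          ≡⟨ cong (n * n *_) (∑ᴸ-sum-comm P (λ π j → δ (lookup π u) i * δ (lookup π v) j * f j)) ⟩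
        n * n * sum (λ j → ∑ᴸ P (λ π → δ (lookup π u) i * δ (lookup π v) j * f j))
          ≡⟨ cong (n * n *_) (sum-cong-≗ {n} (λ j → sym
              (*-distribʳ-∑ᴸ P (f j) (λ π → δ (lookup π u) i * δ (lookup π v) j)))) ⟩
        n * n * sum (λ j → joint i j * f j)
          ≡⟨ *-distribˡ-sum (n * n) (λ j → joint i j * f j) ⟩
        sum (λ j → n * n * (joint i j * f j))
          ≤⟨ sum-mono (λ j → n * n * (joint i j * f j)) (λ j → 2 * length P * f j) pointwise ⟩
        sum (λ j → 2 * length P * f j)
          ≡⟨ *-distribˡ-sum (2 * length P) f ⟨
        2 * length P * sum f  ∎
        where
        open ℕₚ.≤-Reasoning
        expand : ∀ π → δ (lookup π u) i * f (lookup π v) ≡ sum (λ j → δ (lookup π u) i * δ (lookup π v) j * f j)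
        expand π = trans (cong (δ (lookup π u) i *_) (sym (sum-δ (lookup π v) f)))
          (trans (*-distribˡ-sum (δ (lookup π u) i) (λ j → δ (lookup π v) j * f j))
            (sum-cong-≗ {n} (λ j → sym (ℕₚ.*-assoc (δ (lookup π u) i) _ (f j)))))
        pointwise : ∀ j → n * n * (joint i j * f j) ≤ 2 * length P * f j
        pointwise j with i Finₚ.≟ j
        ... | no i≢j = ℕₚ.≤-trans (ℕₚ.≤-reflexive (sym (ℕₚ.*-assoc (n * n) (joint i j) (f j))))
                                  (ℕₚ.*-monoˡ-≤ (f j) (n²*joint 2≤n i≢j))
        ... | yes refl rewrite fi≡0 | ℕₚ.*-zeroʳ (joint i i) | ℕₚ.*-zeroʳ (n * n) = z≤n

  -- Queries whose correct answer changes when two ranks are exchanged.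

  flip : Bool → Bool → ℕ
  flip true  true  = 0
  flip false false = 0
  flip true  false = 1
  flip false true  = 1

  flip-same : ∀ b → flip b b ≡ 0
  flip-same true  = refl
  flip-same false = refl

  flip≤1 : ∀ b b′ → flip b b′ ≤ 1
  flip≤1 true  true  = z≤n
  flip≤1 false false = z≤n
  flip≤1 true  false = ℕₚ.≤-refl
  flip≤1 false true  = ℕₚ.≤-refl

  hamming : ∀ {m} → Vec Bool m → Vec Bool m → ℕ
  hamming []       []         = 0
  hamming (b ∷ bs) (b′ ∷ bs′) = flip b b′ + hamming bs bs′

  module RankSwap {n : ℕ} (2≤n : 2 ≤ n) (lo hi : Fin n) (l : ℕ)
                  (lo<hi : toℕ lo < toℕ hi) (hi<lo+l : toℕ hi < toℕ lo + l) where
    open ∑ℕ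
    private
      P = permutations n

    τ : Permutation′ n
    τ = transpose lo hi

    swapRanks : Vec (Fin n) n → Vec (Fin n) n
    swapRanks = Vec.map (τ ⟨$⟩ʳ_)

    -- The endpoint `e` is left out so that `near e e` vanishes, as `n²*weighted` demands.
    near? : ∀ (e j : Fin n) → Dec ((toℕ lo ≤ toℕ j × toℕ j < toℕ lo + l) × e ≢ j)
    near? e j = inside? (toℕ lo) l j ×-dec ¬? (e Finₚ.≟ j)

    near : Fin n → Fin n → ℕ
    near e = ind ∘ near? e

    sum-near : ∀ e → sum (near e) ≤ l
    sum-near e = ℕₚ.≤-trans (sum-mono (near e) (ind ∘ inside? (toℕ lo) l) λ j → ind-mono (near? e j)
        (inside? (toℕ lo) l j) proj₁)
                            (sum-interval n (toℕ lo) l)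

    -- The successors reproduce `rank`, so that `correctAnswer` is definitionally `less` of the two
    -- looked-up ranks.
    less : Fin n → Fin n → Bool
    less i j = does (suc (toℕ i) <? suc (toℕ j))

    private
      Inside : Fin n → Set
      Inside j = toℕ lo ≤ toℕ j × toℕ j < toℕ lo + l

      outside-≢ : ∀ {j} → ¬ Inside j → j ≢ lo × j ≢ hi
      outside-≢ out = (λ { refl → out (ℕₚ.≤-refl , ℕₚ.<-trans lo<hi hi<lo+l) })
                    , (λ { refl → out (ℕₚ.<⇒≤ lo<hi , hi<lo+l) })

      Endpoint : Fin n → Set
      Endpoint e = toℕ lo ≤ toℕ e × toℕ e ≤ toℕ hi

      -- A rank outside the window lies below `lo` or above `hi`, hence on the same side of
      -- everything between them.
      less-outsideʳ : ∀ {e e′ j} → Endpoint e → Endpoint e′ → ¬ Inside j → less e j ≡ less e′ j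
      less-outsideʳ {e} {e′} {j} (lo≤e , e≤hi) (lo≤e′ , e′≤hi) out with toℕ j <? toℕ lo
      ... | yes j<lo = trans (dec-false (suc (toℕ e) <? suc (toℕ j))
          (λ q → ℕₚ.<-asym (ℕₚ.≤-pred q) (ℕₚ.<-≤-trans j<lo lo≤e)))
                       (sym (dec-false (suc (toℕ e′) <? suc (toℕ j))
                           (λ q → ℕₚ.<-asym (ℕₚ.≤-pred q) (ℕₚ.<-≤-trans j<lo lo≤e′))))
      ... | no  j≮lo = trans (dec-true (suc (toℕ e) <? suc (toℕ j)) (s≤s (ℕₚ.≤-<-trans e≤hi hi<j)))
                       (sym (dec-true (suc (toℕ e′) <? suc (toℕ j)) (s≤s (ℕₚ.≤-<-trans e′≤hi hi<j))))
        where
        hi<j : toℕ hi < toℕ j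
        hi<j = ℕₚ.<-≤-trans hi<lo+l (ℕₚ.≮⇒≥ (λ q → out (ℕₚ.≮⇒≥ j≮lo , q)))

      less-outsideˡ : ∀ {e e′ j} → Endpoint e → Endpoint e′ → ¬ Inside j → less j e ≡ less j e′
      less-outsideˡ {e} {e′} {j} (lo≤e , e≤hi) (lo≤e′ , e′≤hi) out with toℕ j <? toℕ lo
      ... | yes j<lo = trans (dec-true (suc (toℕ j) <? suc (toℕ e)) (s≤s (ℕₚ.<-≤-trans j<lo lo≤e)))
                       (sym (dec-true (suc (toℕ j) <? suc (toℕ e′)) (s≤s (ℕₚ.<-≤-trans j<lo lo≤e′))))
      ... | no  j≮lo = trans (dec-false (suc (toℕ j) <? suc (toℕ e))
          (λ q → ℕₚ.<-asym (ℕₚ.≤-pred q) (ℕₚ.≤-<-trans e≤hi hi<j)))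
                       (sym (dec-false (suc (toℕ j) <? suc (toℕ e′))
                           (λ q → ℕₚ.<-asym (ℕₚ.≤-pred q) (ℕₚ.≤-<-trans e′≤hi hi<j))))
        where
        hi<j : toℕ hi < toℕ j
        hi<j = ℕₚ.<-≤-trans hi<lo+l (ℕₚ.≮⇒≥ (λ q → out (ℕₚ.≮⇒≥ j≮lo , q)))

      lo-endpoint : Endpoint lo
      lo-endpoint = ℕₚ.≤-refl , ℕₚ.<⇒≤ lo<hi
      hi-endpoint : Endpoint hi
      hi-endpoint = ℕₚ.<⇒≤ lo<hi , ℕₚ.≤-refl

    flipped : Fin n → Fin n → ℕ
    flipped i j = flip (less i j) (less (τ ⟨$⟩ʳ i) (τ ⟨$⟩ʳ j))

    touch : Fin n → Fin n → ℕ
    touch i j = δ i lo * near lo j + δ i hi * near hi j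

    private
      flipped-same : ∀ i j {i′ j′} → τ ⟨$⟩ʳ i ≡ i′ → τ ⟨$⟩ʳ j ≡ j′ → less i j ≡ less i′ j′ → flipped i j ≡ 0
      flipped-same i j refl refl eq rewrite eq = flip-same _

      flipped-diagonal : ∀ i → flipped i i ≡ 0
      flipped-diagonal i = cong₂ flip (dec-false (suc (toℕ i) <? suc (toℕ i)) (ℕₚ.<-irrefl refl))
          (dec-false (suc (toℕ (τ ⟨$⟩ʳ i)) <? suc (toℕ (τ ⟨$⟩ʳ i))) (ℕₚ.<-irrefl refl))

      touch-lo : ∀ {j} → Inside j → lo ≢ j → 1 ≤ touch lo j
      touch-lo {j} in-j lo≢j rewrite ind-yes (lo Finₚ.≟ lo) refl | ind-yes (near? lo j) (in-j , lo≢j) = s≤s z≤n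

      touch-hi : ∀ {j} → Inside j → hi ≢ j → 1 ≤ touch hi j
      touch-hi {j} in-j hi≢j rewrite ind-yes (hi Finₚ.≟ hi) refl | ind-yes (near? hi j) (in-j , hi≢j) = ℕₚ.m≤n+m 1 _

    -- Without an endpoint in the pair the exchange fixes both ranks, and next to a rank outside the
    -- window it goes unnoticed. Any other pair of distinct ranks makes one orientation of `touch`
    -- at least `1`, which pays for a change.
    flipped≤touch : ∀ i j → flipped i j ≤ touch i j + touch j i
    flipped≤touch i j with i Finₚ.≟ j
    ... | yes refl = ℕₚ.≤-trans (ℕₚ.≤-reflexive (flipped-diagonal i)) z≤n
    ... | no i≢j = cases (i Finₚ.≟ lo) (i Finₚ.≟ hi) (j Finₚ.≟ lo) (j Finₚ.≟ hi)
      where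
      Goal : Set
      Goal = flipped i j ≤ touch i j + touch j i
      unchanged : ∀ {i′ j′} → τ ⟨$⟩ʳ i ≡ i′ → τ ⟨$⟩ʳ j ≡ j′ → less i j ≡ less i′ j′ → Goal
      unchanged eqᵢ eqⱼ eq = ℕₚ.≤-trans (ℕₚ.≤-reflexive (flipped-same i j eqᵢ eqⱼ eq)) z≤n
      viaˡ : 1 ≤ touch i j → Goal
      viaˡ p = ℕₚ.≤-trans (flip≤1 _ _) (ℕₚ.≤-trans p (ℕₚ.m≤m+n _ _))
      viaʳ : 1 ≤ touch j i → Goal
      viaʳ p = ℕₚ.≤-trans (flip≤1 _ _) (ℕₚ.≤-trans p (ℕₚ.m≤n+m _ (touch i j)))
      fixed : ∀ {k} → ¬ Inside k → τ ⟨$⟩ʳ k ≡ k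
      fixed out = transpose-other lo hi (proj₁ (outside-≢ out)) (proj₂ (outside-≢ out))
      cases : Dec (i ≡ lo) → Dec (i ≡ hi) → Dec (j ≡ lo) → Dec (j ≡ hi) → Goal
      cases (yes refl) _ _ _ with inside? (toℕ lo) l j
      ... | yes j∈ = viaˡ (touch-lo j∈ i≢j)
      ... | no  j∉ = unchanged (transpose-left lo hi) (fixed j∉) (less-outsideʳ lo-endpoint hi-endpoint j∉)
      cases (no _) (yes refl) _ _ with inside? (toℕ lo) l j
      ... | yes j∈ = viaˡ (touch-hi j∈ i≢j)
      ... | no  j∉ = unchanged (transpose-right lo hi) (fixed j∉) (less-outsideʳ hi-endpoint lo-endpoint j∉)
      cases (no _) (no _) (yes refl) _ with inside? (toℕ lo) l i
      ... | yes i∈ = viaʳ (touch-lo i∈ (≢-sym i≢j))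
      ... | no  i∉ = unchanged (fixed i∉) (transpose-left lo hi) (less-outsideˡ lo-endpoint hi-endpoint i∉)
      cases (no _) (no _) (no _) (yes refl) with inside? (toℕ lo) l i
      ... | yes i∈ = viaʳ (touch-hi i∈ (≢-sym i≢j))
      ... | no  i∉ = unchanged (fixed i∉) (transpose-right lo hi) (less-outsideˡ hi-endpoint lo-endpoint i∉)
      cases (no i≢lo) (no i≢hi) (no j≢lo) (no j≢hi) =
        unchanged (transpose-other lo hi i≢lo i≢hi) (transpose-other lo hi j≢lo j≢hi) refl

    -- The factor `4` is the `2` of `n²*weighted`, once for each of the endpoints `lo` and `hi`.
    n²*touch : ∀ u v → n * n * ∑ᴸ P (λ π → touch (lookup π u) (lookup π v)) ≤ 4 * length P * l
    n²*touch u v = begin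
      n * n * ∑ᴸ P (λ π → touch (lookup π u) (lookup π v))
        ≡⟨ cong (n * n *_) (∑ᴸ-distrib-∙ P (at lo) (at hi)) ⟩
      n * n * (∑ᴸ P (at lo) + ∑ᴸ P (at hi))
        ≡⟨ ℕₚ.*-distribˡ-+ (n * n) (∑ᴸ P (at lo)) (∑ᴸ P (at hi)) ⟩
      n * n * ∑ᴸ P (at lo) + n * n * ∑ᴸ P (at hi)
        ≤⟨ ℕₚ.+-mono-≤ (bound lo) (bound hi) ⟩
      2 * length P * l + 2 * length P * l
        ≡⟨ solve 2 (λ p k → con 2 :* p :* k :+ con 2 :* p :* k := con 4 :* p :* k) refl (length P) l ⟩
      4 * length P * l  ∎
      where
      open ℕₚ.≤-Reasoning
      open +-*-Solver
      at : Fin n → Vec (Fin n) n → ℕ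
      at e π = δ (lookup π u) e * near e (lookup π v)
      bound : ∀ e → n * n * ∑ᴸ P (at e) ≤ 2 * length P * l
      bound e = ℕₚ.≤-trans (JointRanks.n²*weighted u v 2≤n (near e) (ind-no (near? e e) (λ (_ , e≢e) → e≢e refl)))
                           (ℕₚ.*-monoʳ-≤ (2 * length P) (sum-near e))

    changed : ∀ {m} → Vec (Query n) m → Vec (Fin n) n → ℕ
    changed qs π = hamming (Vec.map (correctAnswer π) qs) (Vec.map (correctAnswer (swapRanks π)) qs)

    -- The mean number of changed answers is at most `8 l m / n²`: a query contributes `4 l / n²`
    -- for each of its two orientations.
    n²*changed : ∀ {m} (qs : Vec (Query n) m) → n * n * ∑ᴸ P (changed qs) ≤ 8 * length P * l * m
    n²*changed [] = ℕₚ.≤-trans (ℕₚ.≤-reflexive (trans (cong (n * n *_) (zeros P)) (ℕₚ.*-zeroʳ (n * n)))) z≤n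
      where
      zeros : ∀ {A : Set} (xs : List A) → ∑ᴸ xs (λ _ → 0) ≡ 0
      zeros []       = refl
      zeros (_ ∷ xs) = zeros xs
    n²*changed {suc m} (q ∷ qs) = begin
      n * n * ∑ᴸ P (changed (q ∷ qs))
        ≡⟨ cong (n * n *_) (∑ᴸ-distrib-∙ P first (changed qs)) ⟩
      n * n * (∑ᴸ P first + ∑ᴸ P (changed qs))
        ≤⟨ ℕₚ.*-monoʳ-≤ (n * n) (ℕₚ.+-monoˡ-≤ (∑ᴸ P (changed qs)) (∑ᴸ-mono P first≤)) ⟩
      n * n * (∑ᴸ P (λ π → forward π + backward π) + ∑ᴸ P (changed qs))
        ≡⟨ cong (λ k → n * n * (k + ∑ᴸ P (changed qs))) (∑ᴸ-distrib-∙ P forward backward) ⟩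
      n * n * (∑ᴸ P forward + ∑ᴸ P backward + ∑ᴸ P (changed qs))
        ≡⟨ solve 4 (λ k x y z → k :* (x :+ y :+ z) := k :* x :+ k :* y :+ k :* z) refl (n * n) (∑ᴸ P forward)
            (∑ᴸ P backward) (∑ᴸ P (changed qs)) ⟩
      n * n * ∑ᴸ P forward + n * n * ∑ᴸ P backward + n * n * ∑ᴸ P (changed qs)
        ≤⟨ ℕₚ.+-mono-≤ (ℕₚ.+-mono-≤ (n²*touch left right) (n²*touch right left)) (n²*changed qs) ⟩
      4 * length P * l + 4 * length P * l + 8 * length P * l * m
        ≡⟨ solve 3 (λ p k o → con 4 :* p :* k :+ con 4 :* p :* k :+ con 8 :* p :* k :* o := con 8 :* p :* k :*
            (con 1 :+ o)) refl (length P) l m ⟩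
      8 * length P * l * suc m  ∎
      where
      open ℕₚ.≤-Reasoning
      open +-*-Solver
      open Query q
      first forward backward : Vec (Fin n) n → ℕ
      first π = flip (correctAnswer π q) (correctAnswer (swapRanks π) q)
      forward π = touch (lookup π left) (lookup π right)
      backward π = touch (lookup π right) (lookup π left)
      first≤ : ∀ π → first π ≤ forward π + backward π
      first≤ π rewrite Vecₚ.lookup-map left (τ ⟨$⟩ʳ_) π | Vecₚ.lookup-map right (τ ⟨$⟩ʳ_) π =
        flipped≤touch (lookup π left) (lookup π right)

  -- Here ⌊n/2⌋ = 2a + b and h = ⌈n/2⌉: the ranks of low j and high j are at
  -- distance at least a from the median and less than 5a apart.
  module Window (n a b h : ℕ) (n≡ : n ≡ a + a + b + h) (1≤a : 1 ≤ a)
                (⌊⌋≤h : a + a + b ≤ h) (h≤⌈⌉ : h ≤ suc (a + a + b)) where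
    open ℕₚ.≤-Reasoning
    open +-*-Solver

    low<n : ∀ (j : Fin a) → b + toℕ j < n
    low<n j = begin-strict
      b + toℕ j              <⟨ ℕₚ.+-monoʳ-< b (Finₚ.toℕ<n j) ⟩
      b + a                  ≤⟨ ℕₚ.m≤n+m _ (a + h) ⟩
      a + h + (b + a)    ≡⟨ solve 3 (λ a b h → a :+ h :+ (b :+ a) := a :+ a :+ b :+ h) refl a b h ⟩
      a + a + b + h      ≡⟨ n≡ ⟨
      n                        ∎

    high<n : ∀ (j : Fin a) → h + a + toℕ j < n
    high<n j = begin-strict
      h + a + toℕ j        <⟨ ℕₚ.+-monoʳ-< (h + a) (Finₚ.toℕ<n j) ⟩
      h + a + a            ≤⟨ ℕₚ.m≤n+m _ b ⟩
      b + (h + a + a)    ≡⟨ solve 3 (λ a b h → b :+ (h :+ a :+ a) := a :+ a :+ b :+ h) refl a b h ⟩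
      a + a + b + h      ≡⟨ n≡ ⟨
      n                        ∎

    low high : Fin a → Fin n
    low  j = fromℕ< (low<n j)
    high j = fromℕ< (high<n j)

    toℕ-low : ∀ j → toℕ (low j) ≡ b + toℕ j
    toℕ-low j = Finₚ.toℕ-fromℕ< (low<n j)

    toℕ-high : ∀ j → toℕ (high j) ≡ h + a + toℕ j
    toℕ-high j = Finₚ.toℕ-fromℕ< (high<n j)

    low-injective : Injective _≡_ _≡_ low
    low-injective {i} {j} eq = Finₚ.toℕ-injective (ℕₚ.+-cancelˡ-≡ b _ _
      (trans (sym (toℕ-low i)) (trans (cong toℕ eq) (toℕ-low j))))

    high-injective : Injective _≡_ _≡_ high
    high-injective {i} {j} eq = Finₚ.toℕ-injective (ℕₚ.+-cancelˡ-≡ (h + a) _ _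
      (trans (sym (toℕ-high i)) (trans (cong toℕ eq) (toℕ-high j))))

    2≤n : 2 ≤ n
    2≤n = begin
      2                      ≤⟨ ℕₚ.+-mono-≤ 1≤a 1≤a ⟩
      a + a                ≤⟨ ℕₚ.m≤m+n _ (b + h) ⟩
      a + a + (b + h)  ≡⟨ ℕₚ.+-assoc (a + a) b h ⟨
      a + a + b + h    ≡⟨ n≡ ⟨
      n                      ∎

    low<high : ∀ j → toℕ (low j) < toℕ (high j)
    low<high j rewrite toℕ-low j | toℕ-high j = ℕₚ.+-monoˡ-< (toℕ j) (begin-strict
      b                ≤⟨ ℕₚ.≤-trans (ℕₚ.m≤n+m b (a + a)) ⌊⌋≤h ⟩
      h                <⟨ ℕₚ.m<m+n h 1≤a ⟩
      h + a          ∎)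

    -- The gap is `h + a − b ≤ 3a + 1`, where the `1` accounts for odd `n`, and `1 < 2a`.
    high<low+ : ∀ j → toℕ (high j) < toℕ (low j) + 5 * a
    high<low+ j rewrite toℕ-low j | toℕ-high j = begin-strict
      h + a + toℕ j                           ≤⟨ ℕₚ.+-monoˡ-≤ (toℕ j) (ℕₚ.+-monoˡ-≤ a h≤⌈⌉) ⟩
      suc (a + a + b) + a + toℕ j
        ≡⟨ solve 3 (λ a b j → con 1 :+ (a :+ a :+ b) :+ a :+ j := b :+ j :+ con 3 :* a :+ con 1) refl a b (toℕ j) ⟩
      b + toℕ j + 3 * a + 1               <⟨ ℕₚ.+-monoʳ-< (b + toℕ j + 3 * a) (ℕₚ.+-mono-≤ 1≤a 1≤a) ⟩
      b + toℕ j + 3 * a + (a + a)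
        ≡⟨ solve 3 (λ a b j → b :+ j :+ con 3 :* a :+ (a :+ a) := b :+ j :+ con 5 :* a) refl a b (toℕ j) ⟩
      b + toℕ j + 5 * a                     ∎

    -- The distance from the median is doubled to match `distance`, which is `|2i − n| / 2`; the
    -- `suc` turns the 0-based rank into the 1-based one.
    low-rank : ∀ j → 2 * a + 2 * suc (toℕ (low j)) ≤ n
    low-rank j rewrite toℕ-low j = begin
      2 * a + 2 * suc (b + toℕ j)
        ≡⟨ solve 3 (λ a b j → con 2 :* a :+ con 2 :* (con 1 :+ (b :+ j)) := con 2 :* (a :+ b :+ (con 1 :+ j)))
            refl a b (toℕ j) ⟩
      2 * (a + b + suc (toℕ j))         ≤⟨ ℕₚ.*-monoʳ-≤ 2 (ℕₚ.+-monoʳ-≤ (a + b) (Finₚ.toℕ<n j)) ⟩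
      2 * (a + b + a)
        ≡⟨ solve 2 (λ a b → con 2 :* (a :+ b :+ a) := a :+ a :+ b :+ (a :+ a :+ b)) refl a b ⟩
      a + a + b + (a + a + b)       ≤⟨ ℕₚ.+-monoʳ-≤ (a + a + b) ⌊⌋≤h ⟩
      a + a + b + h                     ≡⟨ n≡ ⟨
      n                                       ∎

    high-rank : ∀ j → 2 * a + n ≤ 2 * suc (toℕ (high j))
    high-rank j rewrite toℕ-high j = begin
      2 * a + n                           ≡⟨ cong (2 * a +_) n≡ ⟩
      2 * a + (a + a + b + h)       ≤⟨ ℕₚ.+-monoʳ-≤ (2 * a) (ℕₚ.+-monoˡ-≤ h ⌊⌋≤h) ⟩
      2 * a + (h + h)                   ≤⟨ ℕₚ.m≤m+n _ (2 * suc (toℕ j)) ⟩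
      2 * a + (h + h) + 2 * suc (toℕ j)
        ≡⟨ solve 3 (λ a h j → con 2 :* a :+ (h :+ h) :+ con 2 :* (con 1 :+ j) := con 2 :*
            (con 1 :+ (h :+ a :+ j))) refl a h (toℕ j) ⟩
      2 * suc (h + a + toℕ j)           ∎

  halves : ∀ n a → 4 * a ≤ n →
    ∃[ b ] n ≡ a + a + b + ⌈ n /2⌉ × a + a + b ≤ ⌈ n /2⌉ × ⌈ n /2⌉ ≤ suc (a + a + b)
  halves n a 4a≤n with ℕₚ.m≤n⇒∃[o]m+o≡n 2a≤⌊n/2⌋
    where
    open +-*-Solver
    2a≤⌊n/2⌋ : a + a ≤ ⌊ n /2⌋
    2a≤⌊n/2⌋ = subst (_≤ ⌊ n /2⌋) (sym (ℕₚ.n≡⌊n+n/2⌋ (a + a)))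
      (ℕₚ.⌊n/2⌋-mono (subst (_≤ n) (solve 1 (λ a → con 4 :* a := a :+ a :+ (a :+ a)) refl a) 4a≤n))
  ... | b , eq = b
    , trans (sym (ℕₚ.⌊n/2⌋+⌈n/2⌉≡n n)) (cong (_+ ⌈ n /2⌉) (sym eq))
    , ℕₚ.≤-trans (ℕₚ.≤-reflexive eq) (ℕₚ.⌊n/2⌋≤⌈n/2⌉ n)
    -- `⌈ n /2⌉` unfolds to `⌊ suc n /2⌋`, and `⌊ suc (suc n) /2⌋` to `suc ⌊ n /2⌋`.
    , ℕₚ.≤-trans (ℕₚ.⌊n/2⌋-mono (ℕₚ.n≤1+n (suc n))) (ℕₚ.≤-reflexive (cong suc (sym eq)))

open Combinatorics

-- Order, finite sums and powers over the axiomatised reals.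

module RealProperties {a ℓ₁ ℓ₂ : Level} (R : Reals a ℓ₁ ℓ₂) where
  open Reals R
  open Partition R using (sumOver; mean)
  private module ring = CommutativeRing commutativeRing
  open ring public
    using (refl; sym; trans; reflexive; +-cong; +-congˡ; +-congʳ; *-cong; *-congˡ; *-congʳ;
           +-assoc; +-comm; +-identityˡ; +-identityʳ; *-assoc; *-comm; *-identityˡ; *-identityʳ;
           distribˡ; distribʳ; zeroˡ; zeroʳ; -‿inverseʳ; -‿inverseˡ; -‿cong)
  open RingProperties ring.ring public using (-‿distribˡ-*; -‿distribʳ-*; -‿involutive)
  open SemiringMult ring.semiring using (×-homo-+; ×1-homo-*)
  module < = IsStrictPartialOrder isStrictPartialOrder
  open SemiringSum ring.semiring public using (sum-cong-≋; *-distribˡ-sum; *-distribʳ-sum; ∑-comm; ∑-distrib-+)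
  open ListSum ring.+-commutativeMonoid public using (∑ᴸ-cong; ∑ᴸ-distrib-∙; ∑ᴸ-sum-comm; permutations-invariant)

  private
    ℕ-rawRing : RawRing _ _
    ℕ-rawRing = record { Carrier = ℕ; _≈_ = _≡_; _+_ = ℕ._+_; _*_ = ℕ._*_; -_ = id; 0# = 0; 1# = 1 }

    fromℕ-homomorphism : ℕ-rawRing -Raw-AlmostCommutative⟶ fromCommutativeSemiring ring.commutativeSemiring
    fromℕ-homomorphism = record
      { ⟦_⟧    = fromℕ
      ; +-homo = ×-homo-+ 1#
      ; *-homo = ×1-homo-*
      ; -‿homo = λ _ → refl
      ; 0-homo = refl
      ; 1-homo = +-identityʳ 1#
      }

  -- Unlike Algebra.Solver.Ring.NaturalCoefficients, con k denotes fromℕ k.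
  module Solver = RingSolver _ _ fromℕ-homomorphism
    (λ m n → Maybe.map (λ eq → reflexive (≡.cong fromℕ eq)) (dec⇒maybe (m ℕ.≟ n)))

  ≤-refl : ∀ {x} → x ≤ x
  ≤-refl = <.irrefl refl

  ≤-reflexive : ∀ {x y} → x ≈ y → x ≤ y
  ≤-reflexive x≈y = <.irrefl (sym x≈y)

  -- A hypothetical `z < x` splits at `y` by cotransitivity, and either half contradicts a
  -- hypothesis.
  ≤-trans : ∀ {x y z} → x ≤ y → y ≤ z → x ≤ z
  ≤-trans {y = y} x≤y y≤z z<x = [ y≤z , x≤y ]′ (<-cotrans z<x y)

  <⇒≤ : ∀ {x y} → x < y → x ≤ y
  <⇒≤ x<y y<x = <.irrefl refl (<.trans x<y y<x)

  <-≤-trans : ∀ {x y z} → x < y → y ≤ z → x < z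
  <-≤-trans {z = z} x<y y≤z = [ id , (λ z<y → contradiction z<y y≤z) ]′ (<-cotrans x<y z)

  ≤-preorder : Preorder a ℓ₁ ℓ₂
  ≤-preorder = record
    { Carrier = ℝ
    ; _≈_ = _≈_
    ; _≲_ = _≤_
    ; isPreorder = record { isEquivalence = ring.isEquivalence ; reflexive = ≤-reflexive ; trans = ≤-trans }
    }

  module ≤-Reasoning = PreorderReasoning ≤-preorder
  open ≤-Reasoning

  -- Inequalities are negations, so they may be proved classically.
  by-cases : ∀ {x y p} (P : Set p) → (P → x ≤ y) → (¬ P → x ≤ y) → x ≤ y
  by-cases P if-P if-¬P y<x = if-¬P (λ p → if-P p y<x) y<x

  +-monoˡ-≤ : ∀ {x y} z → x ≤ y → x + z ≤ y + z
  +-monoˡ-≤ {x} {y} z x≤y y+z<x+z = x≤y (<.<-respˡ-≈ (cancel y) (<.<-respʳ-≈ (cancel x) (+-monoˡ-< (- z) y+z<x+z)))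
    where
    cancel : ∀ w → w + z + - z ≈ w
    cancel w = trans (+-assoc w z (- z)) (trans (+-congˡ (-‿inverseʳ z)) (+-identityʳ w))

  +-mono-≤ : ∀ {x y u v} → x ≤ y → u ≤ v → x + u ≤ y + v
  +-mono-≤ {x} {y} {u} {v} x≤y u≤v = begin
    x + u  ≲⟨ +-monoˡ-≤ u x≤y ⟩
    y + u  ≈⟨ +-comm y u ⟩
    u + y  ≲⟨ +-monoˡ-≤ y u≤v ⟩
    v + y  ≈⟨ +-comm v y ⟩
    y + v  ∎

  +-monoʳ-≤ : ∀ {x y} z → x ≤ y → z + x ≤ z + y
  +-monoʳ-≤ z = +-mono-≤ ≤-refl

  +-cancelʳ-≤ : ∀ {x y} z → x + z ≤ y + z → x ≤ y
  +-cancelʳ-≤ z x+z≤y+z y<x = x+z≤y+z (+-monoˡ-< z y<x)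

  x≤x+y : ∀ {x y} → 0# ≤ y → x ≤ x + y
  x≤x+y {x} {y} 0≤y = begin
    x       ≈⟨ +-identityʳ x ⟨
    x + 0#  ≲⟨ +-monoʳ-≤ x 0≤y ⟩
    x + y   ∎

  0≤y-x : ∀ {x y} → x ≤ y → 0# ≤ y - x
  0≤y-x {x} {y} x≤y = begin
    0#     ≈⟨ -‿inverseʳ x ⟨
    x - x  ≲⟨ +-monoˡ-≤ (- x) x≤y ⟩
    y - x  ∎

  y-x+x : ∀ x y → y - x + x ≈ y
  y-x+x x y = trans (+-assoc y (- x) x) (trans (+-congˡ (-‿inverseˡ x)) (+-identityʳ y))

  *-nonNeg : ∀ {x y} → 0# ≤ x → 0# ≤ y → 0# ≤ x * y
  *-nonNeg {x} {y} 0≤x 0≤y = by-cases (0# < x)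
    (λ 0<x → by-cases (0# < y)
      (λ 0<y → <⇒≤ (*-pos 0<x 0<y))
      (λ y≤0 → ≤-reflexive (trans (sym (zeroʳ x)) (*-congˡ (≤-antisym 0≤y y≤0)))))
    (λ x≤0 → ≤-reflexive (trans (sym (zeroˡ y)) (*-congʳ (≤-antisym 0≤x x≤0))))

  *-monoˡ-≤ : ∀ {x y} z → 0# ≤ z → x ≤ y → z * x ≤ z * y
  *-monoˡ-≤ {x} {y} z 0≤z x≤y = begin
    z * x                  ≈⟨ +-identityˡ (z * x) ⟨
    0# + z * x             ≲⟨ +-monoˡ-≤ (z * x) (*-nonNeg 0≤z (0≤y-x x≤y)) ⟩
    z * (y - x) + z * x    ≈⟨ distribˡ z (y - x) x ⟨
    z * (y - x + x)        ≈⟨ *-congˡ (y-x+x x y) ⟩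
    z * y                  ∎

  *-monoʳ-≤ : ∀ {x y} z → 0# ≤ z → x ≤ y → x * z ≤ y * z
  *-monoʳ-≤ {x} {y} z 0≤z x≤y = begin
    x * z  ≈⟨ *-comm x z ⟩
    z * x  ≲⟨ *-monoˡ-≤ z 0≤z x≤y ⟩
    z * y  ≈⟨ *-comm z y ⟩
    y * z  ∎

  *-cancelˡ-≤ : ∀ {x y} (z : ℝ⁺) → val z * x ≤ val z * y → x ≤ y
  *-cancelˡ-≤ {x} {y} z zx≤zy = begin
    x                             ≈⟨ cancel x ⟨
    val (z ⁻¹) * (val z * x)      ≲⟨ *-monoˡ-≤ (val (z ⁻¹)) (<⇒≤ (pos (z ⁻¹))) zx≤zy ⟩
    val (z ⁻¹) * (val z * y)      ≈⟨ cancel y ⟩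
    y                             ∎
    where
    cancel : ∀ w → val (z ⁻¹) * (val z * w) ≈ w
    cancel w = begin-equality
      val (z ⁻¹) * (val z * w)  ≈⟨ *-assoc _ _ w ⟨
      val (z ⁻¹) * val z * w    ≈⟨ *-congʳ (trans (*-comm _ _) (*-inverseʳ z)) ⟩
      1# * w                    ≈⟨ *-identityˡ w ⟩
      w                         ∎

  -x*-x : ∀ x → - x * - x ≈ x * x
  -x*-x x = begin-equality
    - x * - x     ≈⟨ -‿distribˡ-* x (- x) ⟨
    - (x * - x)   ≈⟨ -‿cong (-‿distribʳ-* x x) ⟨
    - - (x * x)   ≈⟨ -‿involutive (x * x) ⟩
    x * x         ∎

  0≤x² : ∀ x → 0# ≤ x * x
  0≤x² x = by-cases (0# ≤ x) (λ 0≤x → *-nonNeg 0≤x 0≤x)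
    (λ 0≰x → ≤-trans (*-nonNeg (0≤-x 0≰x) (0≤-x 0≰x)) (≤-reflexive (-x*-x x)))
    where
    0≤-x : ¬ (0# ≤ x) → 0# ≤ - x
    0≤-x 0≰x = ≤-trans (0≤y-x (λ 0<x → 0≰x (<⇒≤ 0<x))) (≤-reflexive (+-identityˡ (- x)))

  -- Expands `0 ≤ (x − y)²`. Writing `x` as `d + y` with `d = x − y` makes the expansion a semiring
  -- identity.
  2xy≤x²+y² : ∀ x y → fromℕ 2 * (x * y) ≤ x * x + y * y
  2xy≤x²+y² x y = begin
    fromℕ 2 * (x * y)                               ≈⟨ +-identityˡ _ ⟨
    0# + fromℕ 2 * (x * y)                          ≲⟨ +-monoˡ-≤ _ (0≤x² d) ⟩
    d * d + fromℕ 2 * (x * y)                       ≈⟨ +-congˡ (*-congˡ (*-congʳ (y-x+x y x))) ⟨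
    d * d + fromℕ 2 * ((d + y) * y)
      ≈⟨ solve 2 (λ d y → d :* d :+ con 2 :* ((d :+ y) :* y) := (d :+ y) :* (d :+ y) :+ y :* y) refl d y ⟩
    (d + y) * (d + y) + y * y                       ≈⟨ +-congʳ (*-cong (y-x+x y x) (y-x+x y x)) ⟩
    x * x + y * y                                   ∎
    where
    open Solver
    d = x - y

  fromℕ-+ : ∀ m n → fromℕ (m ℕ.+ n) ≈ fromℕ m + fromℕ n
  fromℕ-+ = ×-homo-+ 1#

  fromℕ-* : ∀ m n → fromℕ (m ℕ.* n) ≈ fromℕ m * fromℕ n
  fromℕ-* = ×1-homo-*

  fromℕ-1 : fromℕ 1 ≈ 1#
  fromℕ-1 = +-identityʳ 1#

  0≤fromℕ : ∀ n → 0# ≤ fromℕ n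
  0≤fromℕ zero    = ≤-refl
  0≤fromℕ (suc n) = <⇒≤ (fromℕ-pos n)

  fromℕ-mono-≤ : ∀ {m n} → m ℕ.≤ n → fromℕ m ≤ fromℕ n
  fromℕ-mono-≤ {m} m≤n with ℕₚ.m≤n⇒∃[o]m+o≡n m≤n
  ... | o , ≡.refl = ≤-trans (x≤x+y (0≤fromℕ o)) (≤-reflexive (sym (fromℕ-+ m o)))

  fromℕ-cancel-≤ : ∀ {m n} → fromℕ m ≤ fromℕ n → m ℕ.≤ n
  fromℕ-cancel-≤ {m} {n} fm≤fn with m ℕ.≤? n
  ... | yes m≤n = m≤n
  ... | no  m≰n = contradiction (<-≤-trans n<1+n (fromℕ-mono-≤ (ℕₚ.≰⇒> m≰n))) fm≤fn
    where
    n<1+n : fromℕ n < fromℕ (suc n)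
    n<1+n = <.<-respˡ-≈ (+-identityˡ _) (+-monoˡ-< (fromℕ n) 0<1)

  val-fromℕ⁺ : ∀ n .{{_ : NonZero n}} → val (fromℕ⁺ n) ≈ fromℕ n
  val-fromℕ⁺ (suc n) = refl

  -- The integer part exists classically, which suffices for inequalities.
  floor : ∀ {x} → 0# ≤ x → ¬ ¬ (∃[ n ] fromℕ n ≤ x × x ≤ fromℕ (suc n))
  floor {x} 0≤x ¬floor with archimedean x
  ... | N , x<N = search N (<⇒≤ x<N)
    where
    search : ∀ N → ¬ (x ≤ fromℕ N)
    search zero    x≤0 = ¬floor (0 , 0≤x , ≤-trans x≤0 (0≤fromℕ 1))
    -- Falsity is presented as `1# ≤ 0#`, refuted by `0<1`, so that `by-cases` can decide whether
    -- `fromℕ N ≤ x`.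
    search (suc N) x≤N = by-cases {x = 1#} {y = 0#} (fromℕ N ≤ x)
      (λ N≤x _ → ¬floor (N , N≤x , x≤N))
      (λ N≰x _ → search N (λ N<x → N≰x (<⇒≤ N<x))) 0<1

  sum-mono : ∀ {n} (f g : Fin n → ℝ) → (∀ i → f i ≤ g i) → sum f ≤ sum g
  sum-mono {zero}  f g f≤g = ≤-refl
  sum-mono {suc n} f g f≤g = +-mono-≤ (f≤g zero) (sum-mono (f ∘ suc) (g ∘ suc) (f≤g ∘ suc))

  sum-nonNeg : ∀ {n} (f : Fin n → ℝ) → (∀ i → 0# ≤ f i) → 0# ≤ sum f
  sum-nonNeg {zero}  f 0≤f = ≤-refl
  sum-nonNeg {suc n} f 0≤f = ≤-trans (0≤f zero) (x≤x+y (sum-nonNeg (f ∘ suc) (0≤f ∘ suc)))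

  term≤sum : ∀ {n} (f : Fin n → ℝ) → (∀ i → 0# ≤ f i) → ∀ i → f i ≤ sum f
  term≤sum f 0≤f zero    = x≤x+y (sum-nonNeg (f ∘ suc) (0≤f ∘ suc))
  term≤sum f 0≤f (suc i) = begin
    f (suc i)          ≲⟨ term≤sum (f ∘ suc) (0≤f ∘ suc) i ⟩
    sum (f ∘ suc)      ≲⟨ x≤x+y (0≤f zero) ⟩
    sum (f ∘ suc) + f zero  ≈⟨ +-comm _ _ ⟩
    f zero + sum (f ∘ suc)  ∎

  sum-fromℕ : ∀ {n} (f : Fin n → ℕ) → sum (fromℕ ∘ f) ≈ fromℕ (∑ℕ.sum f)
  sum-fromℕ {zero}  f = refl
  sum-fromℕ {suc n} f = trans (+-congˡ (sum-fromℕ (f ∘ suc))) (sym (fromℕ-+ (f zero) _))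

  sum-const : ∀ n x → sum {n} (λ _ → x) ≈ fromℕ n * x
  sum-const zero    x = sym (zeroˡ x)
  sum-const (suc n) x = trans (+-cong (sym (*-identityˡ x)) (sum-const n x)) (sym (distribʳ x 1# (fromℕ n)))

  sumOver-mono : ∀ {A : Set} {xs : List A} {f g : A → ℝ} → Allᴸ.All (λ x → f x ≤ g x) xs → sumOver xs f ≤ sumOver xs g
  sumOver-mono Allᴸ.[]              = ≤-refl
  sumOver-mono (fx≤gx Allᴸ.∷ f≤g) = +-mono-≤ fx≤gx (sumOver-mono f≤g)

  *-distribˡ-sumOver : ∀ {A : Set} x (xs : List A) f → x * sumOver xs f ≈ sumOver xs (λ y → x * f y)
  *-distribˡ-sumOver x []       f = zeroʳ x
  *-distribˡ-sumOver x (y ∷ xs) f = trans (distribˡ x (f y) _) (+-congˡ (*-distribˡ-sumOver x xs f))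

  sumOver-fromℕ : ∀ {A : Set} (xs : List A) (f : A → ℕ) → sumOver xs (fromℕ ∘ f) ≈ fromℕ (∑ℕ.∑ᴸ xs f)
  sumOver-fromℕ []       f = refl
  sumOver-fromℕ (x ∷ xs) f = trans (+-congˡ (sumOver-fromℕ xs f)) (sym (fromℕ-+ (f x) _))

  sumOver-one : ∀ {A : Set} (xs : List A) → sumOver xs (λ _ → 1#) ≈ fromℕ (length xs)
  sumOver-one []       = refl
  sumOver-one (x ∷ xs) = +-congˡ (sumOver-one xs)

  mean-≥ : ∀ {A : Set} {xs : List A} {f x y} → y ∈ xs → fromℕ (length xs) * x ≤ sumOver xs f → x ≤ mean xs f
  mean-≥ {xs = z ∷ xs} {f} {x} _ nx≤sum = *-cancelˡ-≤ n (begin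
    val n * x                                     ≲⟨ nx≤sum ⟩
    sumOver (z ∷ xs) f                            ≈⟨ *-identityˡ _ ⟨
    1# * sumOver (z ∷ xs) f                       ≈⟨ *-congʳ (*-inverseʳ n) ⟨
    val n * val (n ⁻¹) * sumOver (z ∷ xs) f       ≈⟨ *-assoc _ _ _ ⟩
    val n * mean (z ∷ xs) f                       ∎)
    where
    n = fromℕ⁺ (suc (length xs))

  -- By `0 + 0 = 0` the value `x ^ 0#` is idempotent, and being positive it can be cancelled.
  ^-identity-0 : ∀ x → val (x ^ 0#) ≈ 1#
  ^-identity-0 x = ≤-antisym (*-cancelˡ-≤ (x ^ 0#) (≤-reflexive (sym eq))) (*-cancelˡ-≤ (x ^ 0#) (≤-reflexive eq))
    where
    eq : val (x ^ 0#) * 1# ≈ val (x ^ 0#) * val (x ^ 0#)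
    eq = begin-equality
      val (x ^ 0#) * 1#            ≈⟨ *-identityʳ _ ⟩
      val (x ^ 0#)                 ≈⟨ ^-cong refl (+-identityʳ 0#) ⟨
      val (x ^ (0# + 0#))          ≈⟨ ^-homo-+ x 0# 0# ⟩
      val (x ^ 0#) * val (x ^ 0#)  ∎

  -- Monotonicity in the base is reduced to monotonicity in the exponent: `y = x · (y/x)` with
  -- `y/x ≥ 1`, whence `(y/x) ^ b ≥ (y/x) ^ 0 = 1`.
  ^-monoˡ-≤ : ∀ x y {b} → 0# ≤ b → val x ≤ val y → val (x ^ b) ≤ val (y ^ b)
  ^-monoˡ-≤ x y {b} 0≤b x≤y = begin
    val (x ^ b)                        ≈⟨ *-identityʳ _ ⟨
    val (x ^ b) * 1#                   ≈⟨ *-congˡ (^-identity-0 (y /⁺ x)) ⟨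
    val (x ^ b) * val ((y /⁺ x) ^ 0#)  ≲⟨ *-monoˡ-≤ _ (<⇒≤ (pos (x ^ b))) (^-monoʳ-≤ (y /⁺ x) 1≤y/x 0≤b) ⟩
    val (x ^ b) * val ((y /⁺ x) ^ b)   ≈⟨ ^-distrib-* x (y /⁺ x) b ⟨
    val ((x *⁺ (y /⁺ x)) ^ b)          ≈⟨ ^-cong x*[y/x]≈y refl ⟩
    val (y ^ b)                        ∎
    where
    open Solver
    x*[y/x]≈y : val (x *⁺ (y /⁺ x)) ≈ val y
    x*[y/x]≈y = begin-equality
      val x * (val y * val (x ⁻¹))
        ≈⟨ solve 3 (λ x y z → x :* (y :* z) := y :* (x :* z)) refl (val x) (val y) (val (x ⁻¹)) ⟩
      val y * (val x * val (x ⁻¹))  ≈⟨ *-congˡ (*-inverseʳ x) ⟩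
      val y * 1#                    ≈⟨ *-identityʳ _ ⟩
      val y                         ∎
    1≤y/x : 1# ≤ val (y /⁺ x)
    1≤y/x = *-cancelˡ-≤ x (begin
      val x * 1#                    ≈⟨ *-identityʳ _ ⟩
      val x                         ≲⟨ x≤y ⟩
      val y                         ≈⟨ x*[y/x]≈y ⟨
      val x * val (y /⁺ x)          ∎)

-- Two-point method: product measures, change of measure and second moments.

module TwoPoint {a ℓ₁ ℓ₂ : Level} (R : Reals a ℓ₁ ℓ₂) where
  open Reals R
  open Partition R
  open RealProperties R
  open ≤-Reasoning

  module Expectation {A : Set} (xs : List A) where
    private
      sumOver-mono′ : ∀ {f g : A → ℝ} → (∀ x → f x ≤ g x) → sumOver xs f ≤ sumOver xs g
      sumOver-mono′ f≤g = sumOver-mono (Allᴸ.universal f≤g xs)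

    -- Unlike `expectAnswers`, takes an arbitrary weight per coordinate, because the reference
    -- measure has `base` at some coordinates and a true answer distribution at the others.
    𝔼 : ∀ {m} → Vec (A → ℝ) m → (Vec A m → ℝ) → ℝ
    𝔼 []       f = f []
    𝔼 (w ∷ ws) f = sumOver xs λ x → w x * 𝔼 ws (λ ys → f (x ∷ ys))

    𝔼-cong : ∀ {m} (ws : Vec (A → ℝ) m) {f g} → (∀ ys → f ys ≈ g ys) → 𝔼 ws f ≈ 𝔼 ws g
    𝔼-cong []       f≈g = f≈g []
    𝔼-cong (w ∷ ws) f≈g = ∑ᴸ-cong xs λ x → *-congˡ (𝔼-cong ws λ ys → f≈g (x ∷ ys))

    𝔼-+ : ∀ {m} (ws : Vec (A → ℝ) m) f g → 𝔼 ws (λ ys → f ys + g ys) ≈ 𝔼 ws f + 𝔼 ws g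
    𝔼-+ []       f g = refl
    𝔼-+ (w ∷ ws) f g = trans
      (∑ᴸ-cong xs λ x → trans (*-congˡ (𝔼-+ ws (λ ys → f (x ∷ ys)) (λ ys → g (x ∷ ys)))) (distribˡ _ _ _))
      (∑ᴸ-distrib-∙ xs _ _)

    𝔼-* : ∀ {m} (ws : Vec (A → ℝ) m) c f → 𝔼 ws (λ ys → c * f ys) ≈ c * 𝔼 ws f
    𝔼-* []       c f = refl
    𝔼-* (w ∷ ws) c f = trans
      (∑ᴸ-cong xs λ x → trans (*-congˡ (𝔼-* ws c (λ ys → f (x ∷ ys)))) (x∙yz≈y∙xz (w x) c _))
      (sym (*-distribˡ-sumOver c xs _))
      where
      open Solver
      x∙yz≈y∙xz : ∀ x y z → x * (y * z) ≈ y * (x * z)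
      x∙yz≈y∙xz = solve 3 (λ x y z → x :* (y :* z) := y :* (x :* z)) refl

    𝔼-mono : ∀ {m} {ws : Vec (A → ℝ) m} → All (λ w → ∀ x → 0# ≤ w x) ws →
      ∀ {f g} → (∀ ys → f ys ≤ g ys) → 𝔼 ws f ≤ 𝔼 ws g
    𝔼-mono []                   f≤g = f≤g []
    𝔼-mono {ws = w ∷ _} (0≤w ∷ 0≤ws) f≤g = sumOver-mono′ λ x → *-monoˡ-≤ (w x) (0≤w x) (𝔼-mono 0≤ws λ ys → f≤g (x ∷ ys))

    𝔼-one : ∀ {m} {ws : Vec (A → ℝ) m} → All (λ w → sumOver xs w ≈ 1#) ws → 𝔼 ws (λ _ → 1#) ≈ 1#
    𝔼-one []                      = refl
    𝔼-one (total ∷ totals) = trans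
      (∑ᴸ-cong xs λ x → trans (*-congˡ (𝔼-one totals)) (*-identityʳ _)) total

    𝔼-const : ∀ {m} {ws : Vec (A → ℝ) m} → All (λ w → sumOver xs w ≈ 1#) ws → ∀ c → 𝔼 ws (λ _ → c) ≈ c
    𝔼-const {ws = ws} totals c = begin-equality
      𝔼 ws (λ _ → c)       ≈⟨ 𝔼-cong ws (λ _ → *-identityʳ c) ⟨
      𝔼 ws (λ _ → c * 1#)  ≈⟨ 𝔼-* ws c _ ⟩
      c * 𝔼 ws (λ _ → 1#)  ≈⟨ *-congˡ (𝔼-one totals) ⟩
      c * 1#               ≈⟨ *-identityʳ c ⟩
      c                    ∎

    𝔼-nonNeg : ∀ {m} {ws : Vec (A → ℝ) m} → All (λ w → ∀ x → 0# ≤ w x) ws →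
      ∀ {f} → (∀ ys → 0# ≤ f ys) → 0# ≤ 𝔼 ws f
    𝔼-nonNeg {ws = ws} 0≤ws {f} 0≤f = begin
      0#                       ≈⟨ zeroˡ _ ⟨
      0# * 𝔼 ws (λ _ → 0#)     ≈⟨ 𝔼-* ws 0# _ ⟨
      𝔼 ws (λ _ → 0# * 0#)     ≈⟨ 𝔼-cong ws (λ _ → zeroˡ 0#) ⟩
      𝔼 ws (λ _ → 0#)          ≲⟨ 𝔼-mono 0≤ws 0≤f ⟩
      𝔼 ws f                   ∎

    𝔼-sum : ∀ {m n} {ws : Vec (A → ℝ) m} → All (λ w → sumOver xs w ≈ 1#) ws →
      (f : Fin n → Vec A m → ℝ) → 𝔼 ws (λ ys → sum (λ i → f i ys)) ≈ sum (λ i → 𝔼 ws (f i))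
    𝔼-sum {n = zero}  totals f = 𝔼-const totals 0#
    𝔼-sum {n = suc n} {ws} totals f = trans (𝔼-+ ws (f Fin.zero) _) (+-congˡ (𝔼-sum totals (λ i → f (Fin.suc i))))

  -- The answers to a comparison carry information η about its outcome when the
  -- χ²-divergence of either answer distribution from a common base is η.
  record Information (M : Model) (η : ℝ) : Set (a ⊔ ℓ₁ ⊔ ℓ₂) where
    field
      base              : Answer M → ℝ
      ratio             : Bool → Answer M → ℝ
      base-nonNeg       : ∀ x → 0# ≤ base x
      likelihood-nonNeg : ∀ b x → 0# ≤ likelihood M b x
      η-nonNeg          : 0# ≤ η
      likelihood-ratio  : ∀ b x → likelihood M b x ≈ base x * ratio b x
      base-total        : sumOver (outcomes M) base ≈ 1#
      likelihood-total  : ∀ b → sumOver (outcomes M) (likelihood M b) ≈ 1#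
      χ²                : ∀ b → sumOver (outcomes M) (λ x → base x * (ratio b x * ratio b x)) ≈ 1# + η

  module _ {M : Model} {η : ℝ} (info : Information M η) where
    open Information info
    open Expectation (outcomes M)

    weights : ∀ {m} → Vec Bool m → Vec (Answer M → ℝ) m
    weights = Vec.map (likelihood M)

    weights-nonNeg : ∀ {m} (bs : Vec Bool m) → All (λ w → ∀ x → 0# ≤ w x) (weights bs)
    weights-nonNeg []       = []
    weights-nonNeg (b ∷ bs) = likelihood-nonNeg b ∷ weights-nonNeg bs

    weights-total : ∀ {m} (bs : Vec Bool m) → All (λ w → sumOver (outcomes M) w ≈ 1#) (weights bs)
    weights-total []       = []
    weights-total (b ∷ bs) = likelihood-total b ∷ weights-total bs

    expectAnswers≈𝔼 : ∀ {m} (bs : Vec Bool m) f → expectAnswers M bs f ≈ 𝔼 (weights bs) f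
    expectAnswers≈𝔼 []       f = refl
    expectAnswers≈𝔼 (b ∷ bs) f = ∑ᴸ-cong (outcomes M) λ x → *-congˡ (expectAnswers≈𝔼 bs _)

    -- One coordinate of the reference measure. It is symmetric in the two correct answers, so both
    -- orders of a pair are measured against the same product.
    mix : Bool → Bool → Answer M → ℝ
    mix true  true  = likelihood M true
    mix false false = likelihood M false
    mix true  false = base
    mix false true  = base

    mixRatio : Bool → Bool → Answer M → ℝ
    mixRatio true  true  _ = 1#
    mixRatio false false _ = 1#
    mixRatio true  false   = ratio true
    mixRatio false true    = ratio false

    mix-ratio : ∀ b b′ x → likelihood M b x ≈ mix b b′ x * mixRatio b b′ x
    mix-ratio true  true  x = sym (*-identityʳ _)
    mix-ratio false false x = sym (*-identityʳ _)
    mix-ratio true  false x = likelihood-ratio true x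
    mix-ratio false true  x = likelihood-ratio false x

    growth : ℕ → ℝ
    growth zero    = 1#
    growth (suc k) = (1# + η) * growth k

    growth-+ : ∀ k l → growth (k ℕ.+ l) ≈ growth k * growth l
    growth-+ zero    l = sym (*-identityˡ _)
    growth-+ (suc k) l = trans (*-congˡ (growth-+ k l)) (sym (*-assoc _ _ _))

    0≤growth : ∀ k → 0# ≤ growth k
    0≤growth zero    = <⇒≤ 0<1
    0≤growth (suc k) = *-nonNeg (≤-trans (<⇒≤ 0<1) (x≤x+y η-nonNeg)) (0≤growth k)

    -- That is (1 + η)ᵏ ≤ 1 / (1 − k η).
    growth-bound : ∀ k → growth k ≤ 1# + fromℕ k * η * growth k
    growth-bound zero    = x≤x+y (≤-reflexive (sym (trans (*-congʳ (zeroˡ η)) (zeroˡ _))))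
    growth-bound (suc k) = begin
      (1# + η) * growth k
        ≈⟨ trans (distribʳ _ 1# η) (+-congʳ (*-identityˡ _)) ⟩
      growth k + η * growth k
        ≲⟨ +-monoˡ-≤ (η * growth k) (growth-bound k) ⟩
      1# + fromℕ k * η * growth k + η * growth k
        ≈⟨ solve 4 (λ o k e g → o :+ k :* e :* g :+ e :* g := o :+ (con 1 :+ k) :* e :* g) refl 1# (fromℕ k) η
            (growth k) ⟩
      1# + (fromℕ 1 + fromℕ k) * η * growth k
        ≈⟨ +-congˡ (*-congʳ (*-congʳ (+-congʳ fromℕ-1))) ⟩
      1# + fromℕ (suc k) * η * growth k
        ≲⟨ +-monoʳ-≤ 1# (*-monoˡ-≤ _ (*-nonNeg (0≤fromℕ (suc k)) η-nonNeg) growth≤) ⟩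
      1# + fromℕ (suc k) * η * growth (suc k)  ∎
      where
      open Solver
      growth≤ : growth k ≤ growth (suc k)
      growth≤ = begin
        growth k               ≲⟨ x≤x+y (*-nonNeg η-nonNeg (0≤growth k)) ⟩
        growth k + η * growth k  ≈⟨ trans (distribʳ _ 1# η) (+-congʳ (*-identityˡ _)) ⟨
        (1# + η) * growth k    ∎

    mix-nonNeg : ∀ b b′ x → 0# ≤ mix b b′ x
    mix-nonNeg true  true  = likelihood-nonNeg true
    mix-nonNeg false false = likelihood-nonNeg false
    mix-nonNeg true  false = base-nonNeg
    mix-nonNeg false true  = base-nonNeg

    mix-total : ∀ b b′ → sumOver (outcomes M) (mix b b′) ≈ 1#
    mix-total true  true  = likelihood-total true
    mix-total false false = likelihood-total false
    mix-total true  false = base-total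
    mix-total false true  = base-total

    mix-χ² : ∀ b b′ → sumOver (outcomes M) (λ x → mix b b′ x * (mixRatio b b′ x * mixRatio b b′ x)) ≈ growth (flip b b′)
    mix-χ² true  true  = trans (∑ᴸ-cong (outcomes M) λ x → trans (*-congˡ (*-identityʳ _)) (*-identityʳ _))
        (likelihood-total true)
    mix-χ² false false = trans (∑ᴸ-cong (outcomes M) λ x → trans (*-congˡ (*-identityʳ _)) (*-identityʳ _))
        (likelihood-total false)
    mix-χ² true  false = trans (χ² true) (sym (*-identityʳ _))
    mix-χ² false true  = trans (χ² false) (sym (*-identityʳ _))

    mixes : ∀ {m} → Vec Bool m → Vec Bool m → Vec (Answer M → ℝ) m
    mixes = Vec.zipWith mix

    mixes-nonNeg : ∀ {m} (bs bs′ : Vec Bool m) → All (λ w → ∀ x → 0# ≤ w x) (mixes bs bs′)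
    mixes-nonNeg []       []         = []
    mixes-nonNeg (b ∷ bs) (b′ ∷ bs′) = mix-nonNeg b b′ ∷ mixes-nonNeg bs bs′

    mixes-total : ∀ {m} (bs bs′ : Vec Bool m) → All (λ w → sumOver (outcomes M) w ≈ 1#) (mixes bs bs′)
    mixes-total []       []         = []
    mixes-total (b ∷ bs) (b′ ∷ bs′) = mix-total b b′ ∷ mixes-total bs bs′

    mixes-comm : ∀ {m} (bs bs′ : Vec Bool m) → mixes bs bs′ ≡ mixes bs′ bs
    mixes-comm []           []            = ≡.refl
    mixes-comm (true  ∷ bs) (true  ∷ bs′) = ≡.cong (_ ∷_) (mixes-comm bs bs′)
    mixes-comm (false ∷ bs) (false ∷ bs′) = ≡.cong (_ ∷_) (mixes-comm bs bs′)
    mixes-comm (true  ∷ bs) (false ∷ bs′) = ≡.cong (_ ∷_) (mixes-comm bs bs′)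
    mixes-comm (false ∷ bs) (true  ∷ bs′) = ≡.cong (_ ∷_) (mixes-comm bs bs′)

    hamming-comm : ∀ {m} (bs bs′ : Vec Bool m) → hamming bs bs′ ≡ hamming bs′ bs
    hamming-comm []           []            = ≡.refl
    hamming-comm (true  ∷ bs) (true  ∷ bs′) = hamming-comm bs bs′
    hamming-comm (false ∷ bs) (false ∷ bs′) = hamming-comm bs bs′
    hamming-comm (true  ∷ bs) (false ∷ bs′) = ≡.cong suc (hamming-comm bs bs′)
    hamming-comm (false ∷ bs) (true  ∷ bs′) = ≡.cong suc (hamming-comm bs bs′)

    -- The likelihood ratio of the true answers for `bs` with respect to `mixes bs bs′`.
    density : ∀ {m} → Vec Bool m → Vec Bool m → Vec (Answer M) m → ℝ
    density []       []         []       = 1#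
    density (b ∷ bs) (b′ ∷ bs′) (y ∷ ys) = mixRatio b b′ y * density bs bs′ ys

    change-of-measure : ∀ {m} (bs bs′ : Vec Bool m) f →
      𝔼 (weights bs) f ≈ 𝔼 (mixes bs bs′) (λ ys → density bs bs′ ys * f ys)
    change-of-measure []       []         f = sym (*-identityˡ _)
    change-of-measure (b ∷ bs) (b′ ∷ bs′) f = ∑ᴸ-cong (outcomes M) λ x → begin-equality
      likelihood M b x * 𝔼 (weights bs) (λ ys → f (x ∷ ys))
        ≈⟨ *-cong (mix-ratio b b′ x) (change-of-measure bs bs′ _) ⟩
      mix b b′ x * mixRatio b b′ x * 𝔼 (mixes bs bs′) (λ ys → density bs bs′ ys * f (x ∷ ys))
        ≈⟨ *-assoc _ _ _ ⟩
      mix b b′ x * (mixRatio b b′ x * 𝔼 (mixes bs bs′) (λ ys → density bs bs′ ys * f (x ∷ ys)))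
        ≈⟨ *-congˡ (𝔼-* (mixes bs bs′) _ _) ⟨
      mix b b′ x * 𝔼 (mixes bs bs′) (λ ys → mixRatio b b′ x * (density bs bs′ ys * f (x ∷ ys)))
        ≈⟨ *-congˡ (𝔼-cong (mixes bs bs′) λ ys → *-assoc _ _ _) ⟨
      mix b b′ x * 𝔼 (mixes bs bs′) (λ ys → mixRatio b b′ x * density bs bs′ ys * f (x ∷ ys))  ∎

    -- Second moments of independent coordinates multiply; an unchanged answer contributes `1` and a
    -- changed one `1 + η`.
    density-χ² : ∀ {m} (bs bs′ : Vec Bool m) →
      𝔼 (mixes bs bs′) (λ ys → density bs bs′ ys * density bs bs′ ys) ≈ growth (hamming bs bs′)
    density-χ² []       []         = *-identityˡ 1#
    density-χ² (b ∷ bs) (b′ ∷ bs′) = begin-equality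
      sumOver (outcomes M) (λ x → mix b b′ x * 𝔼 (mixes bs bs′)
          (λ ys → mixRatio b b′ x * density bs bs′ ys * (mixRatio b b′ x * density bs bs′ ys)))
        ≈⟨ ∑ᴸ-cong (outcomes M) (λ x → *-congˡ (trans (𝔼-cong (mixes bs bs′) λ ys → rearrange (mixRatio b b′ x) _)
            (𝔼-* (mixes bs bs′) _ _))) ⟩
      sumOver (outcomes M) (λ x → mix b b′ x *
          (mixRatio b b′ x * mixRatio b b′ x * 𝔼 (mixes bs bs′) (λ ys → density bs bs′ ys * density bs bs′ ys)))
        ≈⟨ ∑ᴸ-cong (outcomes M) (λ x → trans (*-congˡ (*-congˡ (density-χ² bs bs′))) (pull (mix b b′ x) _ _)) ⟩
      sumOver (outcomes M) (λ x → growth (hamming bs bs′) * (mix b b′ x * (mixRatio b b′ x * mixRatio b b′ x)))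
        ≈⟨ *-distribˡ-sumOver _ (outcomes M) _ ⟨
      growth (hamming bs bs′) * sumOver (outcomes M) (λ x → mix b b′ x * (mixRatio b b′ x * mixRatio b b′ x))
        ≈⟨ trans (*-congˡ (mix-χ² b b′)) (*-comm _ _) ⟩
      growth (flip b b′) * growth (hamming bs bs′)
        ≈⟨ growth-+ (flip b b′) _ ⟨
      growth (flip b b′ ℕ.+ hamming bs bs′)  ∎
      where
      open Solver
      rearrange : ∀ r d → r * d * (r * d) ≈ r * r * (d * d)
      rearrange = solve 2 (λ r d → r :* d :* (r :* d) := r :* r :* (d :* d)) refl
      pull : ∀ w r z → w * (r * z) ≈ z * (w * r)
      pull = solve 3 (λ w r z → w :* (r :* z) := z :* (w :* r)) refl

    -- Integrating the square (2D + f − 2)² ≥ 0 for an indicator f and the density D.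
    one-sided : ∀ {m} (bs bs′ : Vec Bool m) f → (∀ ys → f ys * f ys ≈ f ys) →
      fromℕ 3 * 𝔼 (mixes bs bs′) f + fromℕ 4 ≤ fromℕ 4 * 𝔼 (weights bs) f + fromℕ 4 * growth (hamming bs bs′)
    one-sided bs bs′ f f²≈f = +-cancelʳ-≤ (fromℕ 4) (begin
      fromℕ 3 * U f + fromℕ 4 + fromℕ 4
        ≈⟨ solve 1 (λ u → con 3 :* u :+ con 4 :+ con 4 := con 3 :* u :+ con 8 :* con 1) refl (U f) ⟩
      fromℕ 3 * U f + fromℕ 8 * fromℕ 1
        -- The density has mean `1`, so the constant `8` can be moved under the integral as `8 D`, a
        -- cross term of the square.
        ≈⟨ +-congˡ (*-congˡ (trans fromℕ-1 (sym U-D))) ⟩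
      fromℕ 3 * U f + fromℕ 8 * U D
        ≈⟨ +-cong (𝔼-* ws _ f) (𝔼-* ws _ D) ⟨
      U (λ ys → fromℕ 3 * f ys) + U (λ ys → fromℕ 8 * D ys)
        ≈⟨ 𝔼-+ ws _ _ ⟨
      U (λ ys → fromℕ 3 * f ys + fromℕ 8 * D ys)
        ≲⟨ 𝔼-mono (mixes-nonNeg bs bs′) (λ ys → pointwise (D ys) (f ys) (f²≈f ys)) ⟩
      U (λ ys → fromℕ 4 * (D ys * f ys) + fromℕ 4 * (D ys * D ys) + fromℕ 4)
        ≈⟨ trans (𝔼-+ ws _ _) (+-congʳ (𝔼-+ ws _ _)) ⟩
      U (λ ys → fromℕ 4 * (D ys * f ys)) + U (λ ys → fromℕ 4 * (D ys * D ys)) + U (λ _ → fromℕ 4)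
        ≈⟨ +-cong (+-cong (𝔼-* ws _ _) (𝔼-* ws _ _)) (𝔼-const (mixes-total bs bs′) _) ⟩
      fromℕ 4 * U (λ ys → D ys * f ys) + fromℕ 4 * U (λ ys → D ys * D ys) + fromℕ 4
        ≈⟨ +-congʳ (+-cong (*-congˡ (sym (change-of-measure bs bs′ f))) (*-congˡ (density-χ² bs bs′))) ⟩
      fromℕ 4 * 𝔼 (weights bs) f + fromℕ 4 * growth (hamming bs bs′) + fromℕ 4  ∎)
      where
      open Solver
      ws = mixes bs bs′
      U = 𝔼 ws
      D = density bs bs′
      U-D : U D ≈ 1#
      U-D = begin-equality
        U D                           ≈⟨ 𝔼-cong ws (λ ys → *-identityʳ (D ys)) ⟨
        U (λ ys → D ys * 1#)          ≈⟨ change-of-measure bs bs′ _ ⟨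
        𝔼 (weights bs) (λ _ → 1#)     ≈⟨ 𝔼-one (weights-total bs) ⟩
        1#                            ∎
      -- `2xy ≤ x² + y²` at `x = 2d + g`, `y = 2`; adding `g` to both sides lets `g * g ≈ g` cancel.
      pointwise : ∀ d g → g * g ≈ g → fromℕ 3 * g + fromℕ 8 * d ≤ fromℕ 4 * (d * g) + fromℕ 4 * (d * d) + fromℕ 4
      pointwise d g g²≈g = +-cancelʳ-≤ g (begin
        fromℕ 3 * g + fromℕ 8 * d + g
          ≈⟨ solve 2 (λ d g → con 3 :* g :+ con 8 :* d :+ g := con 2 :* ((con 2 :* d :+ g) :* con 2)) refl d g ⟩
        fromℕ 2 * ((fromℕ 2 * d + g) * fromℕ 2)
          ≲⟨ 2xy≤x²+y² (fromℕ 2 * d + g) (fromℕ 2) ⟩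
        (fromℕ 2 * d + g) * (fromℕ 2 * d + g) + fromℕ 2 * fromℕ 2
          ≈⟨ solve 2 (λ d g → (con 2 :* d :+ g) :* (con 2 :* d :+ g) :+ con 2 :* con 2 := con 4 :* (d :* g) :+ con
              4 :* (d :* d) :+ con 4 :+ g :* g) refl d g ⟩
        fromℕ 4 * (d * g) + fromℕ 4 * (d * d) + fromℕ 4 + g * g
          ≈⟨ +-congˡ g²≈g ⟩
        fromℕ 4 * (d * g) + fromℕ 4 * (d * d) + fromℕ 4 + g  ∎)

    -- Complementary events have total mass `1` under the common reference measure, so the two
    -- one-sided bounds add up to `11 ≤ 4T + 8z` with `z = (1 + η)ᵏ`. If `8kη ≤ 1` then `z ≤ 8/7`,
    -- which gives `4T ≥ 1`; otherwise the last term alone suffices. Being linear in `k`, the bound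
    -- can be averaged over the orders.
    two-point : ∀ {m} (bs bs′ : Vec Bool m) f f′ → (∀ ys → f ys * f ys ≈ f ys) → (∀ ys → f′ ys * f′ ys ≈ f′ ys) →
      (∀ ys → 0# ≤ f ys) → (∀ ys → 0# ≤ f′ ys) → (∀ ys → f ys + f′ ys ≈ 1#) →
      1# ≤ fromℕ 4 * (𝔼 (weights bs) f + 𝔼 (weights bs′) f′) + fromℕ 8 * (fromℕ (hamming bs bs′) * η)
    two-point bs bs′ f f′ f²≈f f′²≈f′ 0≤f 0≤f′ f+f′≈1 = by-cases (1# ≤ fromℕ 8 * y)
      (λ 1≤8y → begin
        1#                        ≲⟨ 1≤8y ⟩
        fromℕ 8 * y               ≲⟨ x≤x+y (*-nonNeg (0≤fromℕ 4) 0≤T) ⟩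
        fromℕ 8 * y + fromℕ 4 * T  ≈⟨ +-comm _ _ ⟩
        fromℕ 4 * T + fromℕ 8 * y  ∎)
      (λ 1≰8y → ≤-trans (few-changes (λ 1<8y → 1≰8y (<⇒≤ 1<8y))) (x≤x+y (*-nonNeg (0≤fromℕ 8) 0≤y)))
      where
      open Solver
      T = 𝔼 (weights bs) f + 𝔼 (weights bs′) f′
      z = growth (hamming bs bs′)
      y = fromℕ (hamming bs bs′) * η
      U = 𝔼 (mixes bs bs′)
      0≤y : 0# ≤ y
      0≤y = *-nonNeg (0≤fromℕ (hamming bs bs′)) η-nonNeg
      0≤T : 0# ≤ T
      0≤T = ≤-trans (𝔼-nonNeg (weights-nonNeg bs) 0≤f) (x≤x+y (𝔼-nonNeg (weights-nonNeg bs′) 0≤f′))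
      U-total : U f + U f′ ≈ 1#
      U-total = trans (sym (𝔼-+ (mixes bs bs′) f f′))
          (trans (𝔼-cong (mixes bs bs′) f+f′≈1) (𝔼-one (mixes-total bs bs′)))
      -- The reference measure and the number of changes are symmetric, so `one-sided` applies with
      -- the roles exchanged.
      other-side : fromℕ 3 * U f′ + fromℕ 4 ≤ fromℕ 4 * 𝔼 (weights bs′) f′ + fromℕ 4 * z
      other-side rewrite mixes-comm bs bs′ | hamming-comm bs bs′ = one-sided bs′ bs f′ f′²≈f′
      11≤ : fromℕ 11 ≤ fromℕ 4 * T + fromℕ 8 * z
      11≤ = begin
        fromℕ 11
          ≈⟨ solve 0 (con 11 := con 3 :* con 1 :+ con 8) refl ⟩
        fromℕ 3 * fromℕ 1 + fromℕ 8
          ≈⟨ +-congʳ (*-congˡ (trans fromℕ-1 (sym U-total))) ⟩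
        fromℕ 3 * (U f + U f′) + fromℕ 8
          ≈⟨ solve 2 (λ p q → con 3 :* (p :+ q) :+ con 8 := con 3 :* p :+ con 4 :+ (con 3 :* q :+ con 4)) refl
              (U f) (U f′) ⟩
        fromℕ 3 * U f + fromℕ 4 + (fromℕ 3 * U f′ + fromℕ 4)
          ≲⟨ +-mono-≤ (one-sided bs bs′ f f²≈f) other-side ⟩
        fromℕ 4 * 𝔼 (weights bs) f + fromℕ 4 * z + (fromℕ 4 * 𝔼 (weights bs′) f′ + fromℕ 4 * z)
          ≈⟨ solve 3 (λ p q z → con 4 :* p :+ con 4 :* z :+ (con 4 :* q :+ con 4 :* z) := con 4 :* (p :+ q) :+ con
              8 :* z) refl _ _ z ⟩
        fromℕ 4 * T + fromℕ 8 * z  ∎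
      few-changes : fromℕ 8 * y ≤ 1# → 1# ≤ fromℕ 4 * T
      few-changes 8y≤1 = *-cancelˡ-≤ (fromℕ⁺ 7) (+-cancelʳ-≤ (fromℕ 70) (begin
        fromℕ 7 * 1# + fromℕ 70
          ≈⟨ +-congʳ (*-congˡ fromℕ-1) ⟨
        fromℕ 7 * fromℕ 1 + fromℕ 70
          ≈⟨ solve 0 (con 7 :* con 1 :+ con 70 := con 7 :* con 11) refl ⟩
        fromℕ 7 * fromℕ 11
          ≲⟨ *-monoˡ-≤ (fromℕ 7) (0≤fromℕ 7) 11≤ ⟩
        fromℕ 7 * (fromℕ 4 * T + fromℕ 8 * z)
          ≈⟨ solve 2 (λ t z → con 7 :* (con 4 :* t :+ con 8 :* z) := con 7 :* (con 4 :* t) :+ con 8 :*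
              (con 7 :* z)) refl T z ⟩
        fromℕ 7 * (fromℕ 4 * T) + fromℕ 8 * (fromℕ 7 * z)
          ≲⟨ +-monoʳ-≤ _ (*-monoˡ-≤ (fromℕ 8) (0≤fromℕ 8) 7z≤8) ⟩
        fromℕ 7 * (fromℕ 4 * T) + fromℕ 8 * fromℕ 8
          ≈⟨ +-congˡ (fromℕ-* 8 8) ⟨
        fromℕ 7 * (fromℕ 4 * T) + fromℕ 64
          -- Rounding `64` up to `70 = 77 − 7` discards the slack and leaves exactly the `7` that is
          -- cancelled.
          ≲⟨ +-monoʳ-≤ _ (fromℕ-mono-≤ (ℕₚ.m≤m+n 64 6)) ⟩
        fromℕ 7 * (fromℕ 4 * T) + fromℕ 70  ∎))
        where
        -- `8z ≤ 8 + 8yz ≤ 8 + z`, by `growth-bound` and `8y ≤ 1`.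
        7z≤8 : fromℕ 7 * z ≤ fromℕ 8
        7z≤8 = +-cancelʳ-≤ z (begin
          fromℕ 7 * z + z
            ≈⟨ solve 1 (λ z → con 7 :* z :+ z := con 8 :* z) refl z ⟩
          fromℕ 8 * z
            ≲⟨ *-monoˡ-≤ (fromℕ 8) (0≤fromℕ 8) (growth-bound (hamming bs bs′)) ⟩
          fromℕ 8 * (1# + y * z)
            ≈⟨ trans (distribˡ _ _ _) (+-cong (*-identityʳ _) (sym (*-assoc _ _ _))) ⟩
          fromℕ 8 + fromℕ 8 * y * z
            ≲⟨ +-monoʳ-≤ _ (*-monoʳ-≤ z (0≤growth (hamming bs bs′)) 8y≤1) ⟩
          fromℕ 8 + 1# * z
            ≈⟨ +-congˡ (*-identityˡ z) ⟩
          fromℕ 8 + z  ∎)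

  -- Information carried by one comparison in each of the three models.

  private
    h = val ½

    half : fromℕ 2 * h ≈ 1#
    half = *-inverseʳ (fromℕ⁺ 2)

    0≤h : 0# ≤ h
    0≤h = <⇒≤ (pos ½)

    two-halves : ∀ x → fromℕ 2 * h * x ≈ x
    two-halves x = trans (*-congʳ half) (*-identityˡ x)

  -- Against a fair coin the ratios are `2` and `0`, with second moment `½ · 4 = 1 + 1`.
  noiseless-information : Information noiseless 1#
  noiseless-information = record
    { base              = λ _ → h
    ; ratio             = λ b x → ifCorrect b x (fromℕ 2) 0#
    ; base-nonNeg       = λ _ → 0≤h
    ; likelihood-nonNeg = λ { true true → 0≤1 ; true false → ≤-refl ; false true → ≤-refl ; false false → 0≤1 }
    ; η-nonNeg          = 0≤1
    ; likelihood-ratio  = λ { true true → one ; true false → nil ; false true → nil ; false false → one }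
    ; base-total        = trans (solve 1 (λ h → h :+ (h :+ con 0) := con 2 :* h) refl h) half
    ; likelihood-total  = λ { true  → trans (+-congˡ (+-identityʳ 0#)) (+-identityʳ 1#)
                            ; false → trans (+-identityˡ _) (+-identityʳ 1#) }
    ; χ²                = λ { true  → trans (+-cong χ²-right (trans (+-identityʳ _) χ²-wrong)) (+-identityʳ _)
                            ; false → trans (+-cong χ²-wrong (trans (+-identityʳ _) χ²-right)) (+-identityˡ _) }
    }
    where
    open Solver
    0≤1 = <⇒≤ 0<1
    one : 1# ≈ h * fromℕ 2
    one = sym (trans (*-comm _ _) half)
    nil : 0# ≈ h * 0#
    nil = sym (zeroʳ h)
    χ²-right : h * (fromℕ 2 * fromℕ 2) ≈ 1# + 1#
    χ²-right = trans (solve 1 (λ h → h :* (con 2 :* con 2) := con 2 :* h :+ con 2 :* h) refl h) (+-cong half half)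
    χ²-wrong : h * (0# * 0#) ≈ 0#
    χ²-wrong = trans (*-congˡ (zeroˡ 0#)) (zeroʳ h)

  -- The base erases equally often and otherwise tosses a fair coin. An erasure has ratio `1`, so
  -- the second moment is `(1 − γ) + (γ/2) · 4 = 1 + γ`.
  erasure-information : ∀ (γ : ℝ⁺) → val γ ≤ 1# → Information (erasure (val γ)) (val γ)
  erasure-information γ⁺ γ≤1 = record
    { base              = λ { (just _) → h * γ ; nothing → 1# - γ }
    ; ratio             = λ { b (just x) → ifCorrect b x (fromℕ 2) 0# ; b nothing → 1# }
    ; base-nonNeg       = λ { (just _) → *-nonNeg 0≤h 0≤γ ; nothing → 0≤y-x γ≤1 }
    ; likelihood-nonNeg = λ { true (just true) → 0≤γ ; true (just false) → ≤-refl ; true nothing → 0≤y-x γ≤1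
                            ; false (just true) → ≤-refl ; false (just false) → 0≤γ ; false nothing → 0≤y-x γ≤1 }
    ; η-nonNeg          = 0≤γ
    ; likelihood-ratio  = λ { true (just true) → one ; true (just false) → nil ; true nothing → same
                            ; false (just true) → nil ; false (just false) → one ; false nothing → same }
    ; base-total        = trans
        (solve 3 (λ h g e → h :* g :+ (h :* g :+ (e :+ con 0)) := e :+ con 2 :* h :* g) refl h γ ε)
        (trans (+-congˡ (two-halves γ)) ε+γ)
    ; likelihood-total  = λ { true  → trans (solve 2 (λ g e → g :+ (con 0 :+ (e :+ con 0)) := e :+ g) refl γ ε) ε+γ
                            ; false → trans (solve 2 (λ g e → con 0 :+ (g :+ (e :+ con 0)) := e :+ g) refl γ ε) ε+γ }
    ; χ²                = λ { true  → trans (+-congˡ (+-congˡ (+-congʳ ε-weight))) χ²-true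
                            ; false → trans (+-congˡ (+-congˡ (+-congʳ ε-weight))) χ²-false }
    }
    where
    open Solver
    γ = val γ⁺
    ε = 1# - γ
    0≤γ = <⇒≤ (pos γ⁺)
    ε+γ : ε + γ ≈ 1#
    ε+γ = y-x+x γ 1#
    ε-weight : ε * (1# * 1#) ≈ ε
    ε-weight = trans (*-congˡ (*-identityʳ 1#)) (*-identityʳ ε)
    finish : ε + fromℕ 2 * h * γ + fromℕ 2 * h * γ ≈ 1# + γ
    finish = +-cong (trans (+-congˡ (two-halves γ)) ε+γ) (two-halves γ)
    χ²-true : h * γ * (fromℕ 2 * fromℕ 2) + (h * γ * (0# * 0#) + (ε + 0#)) ≈ 1# + γ
    χ²-true = trans (solve 3 (λ h g e →
      h :* g :* (con 2 :* con 2) :+ (h :* g :* (con 0 :* con 0) :+ (e :+ con 0))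
        := e :+ con 2 :* h :* g :+ con 2 :* h :* g) refl h γ ε) finish
    χ²-false : h * γ * (0# * 0#) + (h * γ * (fromℕ 2 * fromℕ 2) + (ε + 0#)) ≈ 1# + γ
    χ²-false = trans (solve 3 (λ h g e →
      h :* g :* (con 0 :* con 0) :+ (h :* g :* (con 2 :* con 2) :+ (e :+ con 0))
        := e :+ con 2 :* h :* g :+ con 2 :* h :* g) refl h γ ε) finish
    one : γ ≈ h * γ * fromℕ 2
    one = trans (sym (two-halves γ)) (solve 2 (λ h g → con 2 :* h :* g := h :* g :* con 2) refl h γ)
    same : ε ≈ ε * 1#
    same = sym (*-identityʳ ε)
    nil : 0# ≈ h * γ * 0#
    nil = sym (zeroʳ _)

  -- Against a fair coin the ratios are `1 + γ` and `1 − γ`; in the mean of their squares the linear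
  -- terms cancel, which is why `γ` enters squared.
  noisy-information : ∀ (γ : ℝ⁺) → val γ ≤ 1# → Information (noisy (val γ)) (val γ * val γ)
  noisy-information γ⁺ γ≤1 = record
    { base              = λ _ → h
    ; ratio             = λ b x → ifCorrect b x (1# + γ) ε
    ; base-nonNeg       = λ _ → 0≤h
    ; likelihood-nonNeg = λ { true true → 0≤right ; true false → 0≤wrong ; false true → 0≤wrong ; false false →
        0≤right }
    ; η-nonNeg          = *-nonNeg 0≤γ 0≤γ
    ; likelihood-ratio  = λ { true true → right ; true false → wrong ; false true → wrong ; false false → right }
    ; base-total        = trans (solve 1 (λ h → h :+ (h :+ con 0) := con 2 :* h) refl h) half
    ; likelihood-total  = λ { true  → trans (+-cong right (trans (+-identityʳ _) wrong)) unit
                            ; false → trans (+-cong wrong (trans (+-identityʳ _) right)) (trans (+-comm _ _) unit) }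
    ; χ²                = λ { true  → trans (+-congˡ (+-identityʳ _)) square
                            ; false → trans (+-congˡ (+-identityʳ _)) (trans (+-comm _ _) square) }
    }
    where
    open Solver
    γ = val γ⁺
    ε = 1# - γ
    0≤γ = <⇒≤ (pos γ⁺)
    ε+γ : ε + γ ≈ 1#
    ε+γ = y-x+x γ 1#
    right : h + h * γ ≈ h * (1# + γ)
    right = trans (+-congʳ (sym (*-identityʳ h))) (sym (distribˡ h 1# γ))
    wrong : h - h * γ ≈ h * ε
    wrong = trans (+-cong (sym (*-identityʳ h)) (-‿distribʳ-* h γ)) (sym (distribˡ h 1# (- γ)))
    0≤right : 0# ≤ h + h * γ
    0≤right = ≤-trans 0≤h (x≤x+y (*-nonNeg 0≤h 0≤γ))
    0≤wrong : 0# ≤ h - h * γ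
    0≤wrong = ≤-trans (*-nonNeg 0≤h (0≤y-x γ≤1)) (≤-reflexive (sym wrong))
    unit : h * (1# + γ) + h * ε ≈ 1#
    unit = begin-equality
      h * (1# + γ) + h * ε  ≈⟨ solve 4 (λ h o g e → h :* (o :+ g) :+ h :* e := h :* (o :+ (e :+ g))) refl h 1# γ ε ⟩
      h * (1# + (ε + γ))    ≈⟨ *-congˡ (+-congˡ ε+γ) ⟩
      h * (1# + 1#)         ≈⟨ solve 2 (λ h o → h :* (o :+ o) := con 2 :* h :* o) refl h 1# ⟩
      fromℕ 2 * h * 1#      ≈⟨ two-halves 1# ⟩
      1#                    ∎
    square : h * ((1# + γ) * (1# + γ)) + h * (ε * ε) ≈ 1# + γ * γ
    square = begin-equality
      h * ((1# + γ) * (1# + γ)) + h * (ε * ε)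
        -- Replacing `1#` by `ε + γ` leaves a semiring identity, free of subtraction.
        ≈⟨ +-congʳ (*-congˡ (*-cong (+-congʳ ε+γ) (+-congʳ ε+γ))) ⟨
      h * ((ε + γ + γ) * (ε + γ + γ)) + h * (ε * ε)
        ≈⟨ solve 3 (λ h g e → h :* ((e :+ g :+ g) :* (e :+ g :+ g)) :+ h :* (e :* e)
             := con 2 :* h :* ((e :+ g) :* (e :+ g) :+ g :* g)) refl h γ ε ⟩
      fromℕ 2 * h * ((ε + γ) * (ε + γ) + γ * γ)
        ≈⟨ two-halves _ ⟩
      (ε + γ) * (ε + γ) + γ * γ
        ≈⟨ +-congʳ (trans (*-cong ε+γ ε+γ) (*-identityʳ 1#)) ⟩
      1# + γ * γ  ∎

-- Mistakes at one pair of ranks, averaged over the orders.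

module LowerBound {a ℓ₁ ℓ₂ : Level} (R : Reals a ℓ₁ ℓ₂) where
  open Reals R
  open Partition R
  open RealProperties R
  open TwoPoint R
  open ≤-Reasoning

  accepted rejected : Side → ℝ
  accepted accept = 1#
  accepted reject = 0#
  rejected accept = 0#
  rejected reject = 1#

  accepted-idem : ∀ s → accepted s * accepted s ≈ accepted s
  accepted-idem accept = *-identityˡ 1#
  accepted-idem reject = zeroˡ 0#

  rejected-idem : ∀ s → rejected s * rejected s ≈ rejected s
  rejected-idem accept = zeroˡ 0#
  rejected-idem reject = *-identityˡ 1#

  0≤accepted : ∀ s → 0# ≤ accepted s
  0≤accepted accept = <⇒≤ 0<1
  0≤accepted reject = ≤-refl

  0≤rejected : ∀ s → 0# ≤ rejected s
  0≤rejected accept = ≤-refl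
  0≤rejected reject = <⇒≤ 0<1

  accepted+rejected : ∀ s → accepted s + rejected s ≈ 1#
  accepted+rejected accept = +-identityʳ 1#
  accepted+rejected reject = +-identityˡ 1#

  δ′ : ∀ {n} → Fin n → Fin n → ℝ
  δ′ i j = fromℕ (δ i j)

  module NonAdaptiveAlgorithm {M : Model} {η : ℝ} (info : Information M η)
           {n m : ℕ} (qs : Vec (Query n) m) (decide : Vec (Answer M) m → Fin n → Side) where
    open Information info
    open Expectation (outcomes M)
    private
      P = permutations n

    answers : Vec (Fin n) n → Vec Bool m
    answers π = Vec.map (correctAnswer π) qs

    acc rej : Vec (Fin n) n → Fin n → ℝ
    acc π x = 𝔼 (weights info (answers π)) (λ ys → accepted (decide ys x))
    rej π x = 𝔼 (weights info (answers π)) (λ ys → rejected (decide ys x))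

    0≤acc : ∀ π x → 0# ≤ acc π x
    0≤acc π x = 𝔼-nonNeg (weights-nonNeg info (answers π)) (λ ys → 0≤accepted (decide ys x))

    0≤rej : ∀ π x → 0# ≤ rej π x
    0≤rej π x = 𝔼-nonNeg (weights-nonNeg info (answers π)) (λ ys → 0≤rejected (decide ys x))

    -- Averages over the answers for a fixed order. The elements of ranks `lo` and `hi` are picked
    -- out by a sum over all elements, the shape of `weightedError`, so that the sums can be
    -- exchanged later.
    mistakes : Fin n → Fin n → Vec (Fin n) n → ℝ
    mistakes lo hi π = sum λ x → δ′ lo (lookup π x) * acc π x + δ′ hi (lookup π x) * rej π x

    module _ (2≤n : 2 ℕ.≤ n) (lo hi : Fin n) (l : ℕ)
             (lo<hi : toℕ lo ℕ.< toℕ hi) (hi<lo+l : toℕ hi ℕ.< toℕ lo ℕ.+ l) where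
      open RankSwap 2≤n lo hi l lo<hi hi<lo+l

      accLow rejLow : Vec (Fin n) n → ℝ
      accLow π = sum λ x → δ′ lo (lookup π x) * acc π x
      rejLow π = sum λ x → δ′ lo (lookup π x) * rej (swapRanks π) x

      -- Reindexing the second half by `swapRanks` turns the rejection of the element of rank `hi`
      -- into the rejection, after the exchange, of the element that had rank `lo`; both halves then
      -- speak of one element.
      sum-mistakes : sumOver P (mistakes lo hi) ≈ sumOver P (λ π → accLow π + rejLow π)
      sum-mistakes = begin-equality
        sumOver P (mistakes lo hi)
          ≈⟨ ∑ᴸ-cong P (λ π → ∑-distrib-+ (λ x → δ′ lo (lookup π x) * acc π x) (λ x → δ′ hi (lookup π x) * rej π x)) ⟩
        sumOver P (λ π → accLow π + rejHigh π)
          ≈⟨ ∑ᴸ-distrib-∙ P accLow rejHigh ⟩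
        sumOver P accLow + sumOver P rejHigh
          ≈⟨ +-congˡ (permutations-invariant τ rejHigh) ⟩
        sumOver P accLow + sumOver P (rejHigh ∘ swapRanks)
          ≈⟨ +-congˡ (∑ᴸ-cong P (λ π → sum-cong-≋ {n} (λ x → *-congʳ (reflexive (≡.cong fromℕ (relabel π x)))))) ⟩
        sumOver P accLow + sumOver P rejLow
          ≈⟨ ∑ᴸ-distrib-∙ P accLow rejLow ⟨
        sumOver P (λ π → accLow π + rejLow π)  ∎
        where
        rejHigh : Vec (Fin n) n → ℝ
        rejHigh π = sum λ x → δ′ hi (lookup π x) * rej π x
        relabel : ∀ π x → δ hi (lookup (swapRanks π) x) ≡ δ lo (lookup π x)
        relabel π x = ≡.trans (≡.cong₂ δ (≡.sym (transpose-left lo hi)) (Vecₚ.lookup-map x (τ ⟨$⟩ʳ_) π))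
                              (δ-injective (⟨$⟩ʳ-injective τ) lo (lookup π x))

      0≤δ* : ∀ (π : Vec (Fin n) n) x {y} → 0# ≤ y → 0# ≤ δ′ lo (lookup π x) * y
      0≤δ* π x 0≤y = *-nonNeg (0≤fromℕ (δ lo (lookup π x))) 0≤y

      -- Distinctness of the entries provides an element `x` of rank `lo`. Accepting `x` is the
      -- mistake before the exchange and rejecting it afterwards; these are complementary events of
      -- the same answers.
      some-mistake : Allᴸ.All (λ π → 1# ≤ fromℕ 4 * (accLow π + rejLow π) + fromℕ 8 * (fromℕ (changed qs π) * η)) P
      some-mistake = Allᴸ.map (λ {π} uniq → bound π
          (injective⇒surjective (λ {x} {y} → Uniqueₚ.lookup-injective uniq x y) lo)) (permutations-distinct n)
        where
        bound : ∀ π → ∃[ x ] lookup π x ≡ lo → 1# ≤ fromℕ 4 * (accLow π + rejLow π) + fromℕ 8 *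
            (fromℕ (changed qs π) * η)
        bound π (x , πx≡lo) = begin
          1#
            ≲⟨ two-point info (answers π) (answers (swapRanks π)) (λ ys → accepted (decide ys x))
                (λ ys → rejected (decide ys x))
                 (λ ys → accepted-idem (decide ys x)) (λ ys → rejected-idem (decide ys x))
                 (λ ys → 0≤accepted (decide ys x)) (λ ys → 0≤rejected (decide ys x))
                     (λ ys → accepted+rejected (decide ys x)) ⟩
          fromℕ 4 * (acc π x + rej (swapRanks π) x) + fromℕ 8 * (fromℕ (changed qs π) * η)
            ≲⟨ +-monoˡ-≤ _ (*-monoˡ-≤ (fromℕ 4) (0≤fromℕ 4) (+-mono-≤
                 (only (acc π) (0≤acc π)) (only (rej (swapRanks π)) (0≤rej (swapRanks π))))) ⟩
          fromℕ 4 * (accLow π + rejLow π) + fromℕ 8 * (fromℕ (changed qs π) * η)  ∎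
          where
          only : ∀ f → (∀ y → 0# ≤ f y) → f x ≤ sum (λ y → δ′ lo (lookup π y) * f y)
          only f 0≤f = begin
            f x                          ≈⟨ *-identityˡ (f x) ⟨
            1# * f x                     ≈⟨ *-congʳ fromℕ-1 ⟨
            fromℕ 1 * f x
              ≈⟨ *-congʳ (reflexive (≡.cong fromℕ (ind-yes (lo Finₚ.≟ lookup π x) (≡.sym πx≡lo)))) ⟨
            δ′ lo (lookup π x) * f x     ≲⟨ term≤sum (λ y → δ′ lo (lookup π y) * f y) (λ y → 0≤δ* π y (0≤f y)) x ⟩
            sum (λ y → δ′ lo (lookup π y) * f y)  ∎

      mistakes-bound : fromℕ (length P) ≤ fromℕ 4 * sumOver P (mistakes lo hi) + fromℕ 8 *
          (fromℕ (∑ℕ.∑ᴸ P (changed qs)) * η)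
      mistakes-bound = begin
        fromℕ (length P)
          ≈⟨ sumOver-one P ⟨
        sumOver P (λ _ → 1#)
          ≲⟨ sumOver-mono some-mistake ⟩
        sumOver P (λ π → fromℕ 4 * (accLow π + rejLow π) + fromℕ 8 * (fromℕ (changed qs π) * η))
          ≈⟨ ∑ᴸ-distrib-∙ P _ _ ⟩
        sumOver P (λ π → fromℕ 4 * (accLow π + rejLow π)) + sumOver P (λ π → fromℕ 8 * (fromℕ (changed qs π) * η))
          ≈⟨ +-cong (*-distribˡ-sumOver (fromℕ 4) P _) (*-distribˡ-sumOver (fromℕ 8) P _) ⟨
        fromℕ 4 * sumOver P (λ π → accLow π + rejLow π) + fromℕ 8 * sumOver P (λ π → fromℕ (changed qs π) * η)
          ≈⟨ +-cong (*-congˡ sum-mistakes) (*-congˡ count) ⟨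
        fromℕ 4 * sumOver P (mistakes lo hi) + fromℕ 8 * (fromℕ (∑ℕ.∑ᴸ P (changed qs)) * η)  ∎
        where
        count : fromℕ (∑ℕ.∑ᴸ P (changed qs)) * η ≈ sumOver P (λ π → fromℕ (changed qs π) * η)
        count = begin-equality
          fromℕ (∑ℕ.∑ᴸ P (changed qs)) * η            ≈⟨ *-comm _ η ⟩
          η * fromℕ (∑ℕ.∑ᴸ P (changed qs))            ≈⟨ *-congˡ (sumOver-fromℕ P (changed qs)) ⟨
          η * sumOver P (fromℕ ∘ changed qs)          ≈⟨ *-distribˡ-sumOver η P _ ⟩
          sumOver P (λ π → η * fromℕ (changed qs π))  ≈⟨ ∑ᴸ-cong P (λ π → *-comm η _) ⟩
          sumOver P (λ π → fromℕ (changed qs π) * η)  ∎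

      -- The `40` is the `8` of `n²*changed` times the `5` of the window length; the `16` makes the
      -- correction in `mistakes-bound` at most one half.
      few-changes : .{{_ : NonZero n}} → ∀ (d : ℝ⁺) a → fromℕ m ≤ val d * fromℕ n → l ℕ.≤ 5 ℕ.* a →
        fromℕ 16 * fromℕ 40 * (fromℕ a * (val d * η)) ≤ fromℕ n →
        fromℕ 16 * (fromℕ (∑ℕ.∑ᴸ P (changed qs)) * η) ≤ fromℕ (length P)
      few-changes d a m≤dn l≤5a sparse = *-cancelˡ-≤ (fromℕ⁺ n *⁺ fromℕ⁺ n) (begin
        val (fromℕ⁺ n) * val (fromℕ⁺ n) * (c₁₆ * (κ * η))
          ≈⟨ *-congʳ (*-cong (val-fromℕ⁺ n) (val-fromℕ⁺ n)) ⟩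
        N * N * (c₁₆ * (κ * η))
          ≈⟨ solve 4 (λ N c κ η → N :* N :* (c :* (κ :* η)) := c :* η :* (N :* N :* κ)) refl N c₁₆ κ η ⟩
        c₁₆ * η * (N * N * κ)
          ≲⟨ *-monoˡ-≤ _ (*-nonNeg (0≤fromℕ 16) η-nonNeg) counting ⟩
        c₁₆ * η * (c₄₀ * A * p * fromℕ m)
          ≲⟨ *-monoˡ-≤ _ (*-nonNeg (0≤fromℕ 16) η-nonNeg)
              (*-monoˡ-≤ _ (*-nonNeg (*-nonNeg (0≤fromℕ 40) (0≤fromℕ a)) (0≤fromℕ (length P))) m≤dn) ⟩
        c₁₆ * η * (c₄₀ * A * p * (D * N))
          ≈⟨ solve 7 (λ x η y A p D N → x :* η :* (y :* A :* p :* (D :* N)) := x :* y :* (A :* (D :* η)) :*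
              (N :* p)) refl c₁₆ η c₄₀ A p D N ⟩
        c₁₆ * c₄₀ * (A * (D * η)) * (N * p)
          ≲⟨ *-monoʳ-≤ _ (*-nonNeg (0≤fromℕ n) (0≤fromℕ (length P))) sparse ⟩
        N * (N * p)
          ≈⟨ *-assoc N N p ⟨
        N * N * p
          ≈⟨ *-congʳ (*-cong (val-fromℕ⁺ n) (val-fromℕ⁺ n)) ⟨
        val (fromℕ⁺ n) * val (fromℕ⁺ n) * p  ∎)
        where
        open Solver
        c₁₆ = fromℕ 16
        c₄₀ = fromℕ 40
        N = fromℕ n
        A = fromℕ a
        D = val d
        p = fromℕ (length P)
        κ = fromℕ (∑ℕ.∑ᴸ P (changed qs))
        in-ℕ : n ℕ.* n ℕ.* ∑ℕ.∑ᴸ P (changed qs) ℕ.≤ 40 ℕ.* a ℕ.* length P ℕ.* m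
        in-ℕ = ℕₚ.≤-trans (n²*changed qs) (ℕₚ.≤-trans (ℕₚ.*-monoˡ-≤ m (ℕₚ.*-monoʳ-≤ (8 ℕ.* length P) l≤5a))
          (ℕₚ.≤-reflexive (NS.solve 3 (λ a p m → NS.con 8 NS.:* p NS.:* (NS.con 5 NS.:* a) NS.:* m NS.:= NS.con 40
              NS.:* a NS.:* p NS.:* m) ≡.refl a (length P) m)))
          where module NS = +-*-Solver
        counting : N * N * κ ≤ c₄₀ * A * p * fromℕ m
        counting = begin
          N * N * κ                                  ≈⟨ trans (fromℕ-* (n ℕ.* n) _) (*-congʳ (fromℕ-* n n)) ⟨
          fromℕ (n ℕ.* n ℕ.* ∑ℕ.∑ᴸ P (changed qs))   ≲⟨ fromℕ-mono-≤ in-ℕ ⟩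
          fromℕ (40 ℕ.* a ℕ.* length P ℕ.* m)
            ≈⟨ trans (fromℕ-* (40 ℕ.* a ℕ.* length P) m)
                (*-congʳ (trans (fromℕ-* (40 ℕ.* a) (length P)) (*-congʳ (fromℕ-* 40 a)))) ⟩
          c₄₀ * A * p * fromℕ m                      ∎

      -- Doubling `mistakes-bound` gives `2p ≤ 8s + 16κη`, and `few` lets one copy of `p` absorb the
      -- correction: on average at least `1/8` mistake per pair.
      many-mistakes : fromℕ 16 * (fromℕ (∑ℕ.∑ᴸ P (changed qs)) * η) ≤ fromℕ (length P) →
        fromℕ (length P) ≤ fromℕ 8 * sumOver P (mistakes lo hi)
      many-mistakes few = +-cancelʳ-≤ p (begin
        p + p                         ≈⟨ solve 1 (λ p → p :+ p := con 2 :* p) refl p ⟩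
        fromℕ 2 * p                   ≲⟨ *-monoˡ-≤ (fromℕ 2) (0≤fromℕ 2) mistakes-bound ⟩
        fromℕ 2 * (fromℕ 4 * s + fromℕ 8 * κη)
          ≈⟨ solve 2 (λ s k → con 2 :* (con 4 :* s :+ con 8 :* k) := con 8 :* s :+ con 16 :* k) refl s κη ⟩
        fromℕ 8 * s + fromℕ 16 * κη   ≲⟨ +-monoʳ-≤ _ few ⟩
        fromℕ 8 * s + p               ∎)
        where
        open Solver
        p = fromℕ (length P)
        s = sumOver P (mistakes lo hi)
        κη = fromℕ (∑ℕ.∑ᴸ P (changed qs)) * η

  -- By injectivity at most one `j` hits `i`, so the left side is `v` or `0`, and `v ≤ w` has to be
  -- known only on a hit.
  sum-δ≤ : ∀ {m n} {g : Fin m → Fin n} → Injective _≡_ _≡_ g → ∀ i v {w} → 0# ≤ v → 0# ≤ w →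
    (∀ j → g j ≡ i → v ≤ w) → v * sum (λ j → δ′ (g j) i) ≤ w
  sum-δ≤ {g = g} g-inj i v {w} 0≤v 0≤w v≤w with Finₚ.any? (λ j → g j Finₚ.≟ i)
  ... | yes (j , gj≡i) = begin
    v * sum (λ j → δ′ (g j) i)              ≈⟨ *-congˡ (sum-fromℕ (λ j → δ (g j) i)) ⟩
    v * fromℕ (∑ℕ.sum (λ j → δ (g j) i))    ≲⟨ *-monoˡ-≤ v 0≤v (fromℕ-mono-≤ (∑ℕ.sum-δ-injective g-inj i)) ⟩
    v * fromℕ 1                             ≈⟨ trans (*-congˡ fromℕ-1) (*-identityʳ v) ⟩
    v                                       ≲⟨ v≤w j gj≡i ⟩
    w                                       ∎
  ... | no miss = begin
    v * sum (λ j → δ′ (g j) i)              ≈⟨ *-congˡ (sum-fromℕ (λ j → δ (g j) i)) ⟩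
    v * fromℕ (∑ℕ.sum (λ j → δ (g j) i))
      ≈⟨ *-congˡ (reflexive (≡.cong fromℕ (∑ℕ.sum-zero _ (λ j → ind-no (g j Finₚ.≟ i) (λ eq → miss (j , eq)))))) ⟩
    v * 0#                                  ≈⟨ zeroʳ v ⟩
    0#                                      ≲⟨ 0≤w ⟩
    w                                       ∎

  -- Weighted error collected over the window of pairs, and the constants.

  module _ {c : ℝ} (0≤c : 0# ≤ c) where

    0≤errorOf : ∀ n i s → 0# ≤ errorOf c n i s
    0≤errorOf n i reject with n ℕ.<? 2 ℕ.* i
    ... | yes n<2i = <⇒≤ (pos (distance n i (≡.≢-sym (ℕₚ.<⇒≢ n<2i)) ^ c))
    ... | no  _    = ≤-refl
    0≤errorOf n i accept with 2 ℕ.* i ℕ.<? n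
    ... | yes 2i<n = <⇒≤ (pos (distance n i (ℕₚ.<⇒≢ 2i<n) ^ c))
    ... | no  _    = ≤-refl

    distance-≥ : ∀ n i (2i≢n : 2 ℕ.* i ≢ n) k → 2 ℕ.* k ℕ.≤ ∣ 2 ℕ.* i - n ∣ → fromℕ k ≤ val (distance n i 2i≢n)
    distance-≥ n i 2i≢n k 2k≤ = begin
      fromℕ k                                      ≈⟨ trans (*-congʳ (*-inverseʳ (fromℕ⁺ 2))) (*-identityˡ _) ⟨
      fromℕ 2 * val ½ * fromℕ k
        ≈⟨ solve 3 (λ t h k → t :* h :* k := t :* k :* h) refl (fromℕ 2) (val ½) (fromℕ k) ⟩
      fromℕ 2 * fromℕ k * val ½                    ≈⟨ *-congʳ (fromℕ-* 2 k) ⟨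
      fromℕ (2 ℕ.* k) * val ½                      ≲⟨ *-monoʳ-≤ (val ½) (<⇒≤ (pos ½)) (fromℕ-mono-≤ 2k≤) ⟩
      fromℕ ∣ 2 ℕ.* i - n ∣ * val ½                ≈⟨ *-congʳ (val-fromℕ⁺ ∣ 2 ℕ.* i - n ∣ {{_}}) ⟨
      val (distance n i 2i≢n)                      ∎
      where open Solver

    -- `far` has the shape of `low-rank` with `a = suc k`; it also forces the branch of `errorOf`
    -- that charges the mistake. That the weight grows with the distance needs `c ≥ 0`.
    errorOf-accept-≥ : ∀ n i k → 2 ℕ.* suc k ℕ.+ 2 ℕ.* i ℕ.≤ n → val (fromℕ⁺ (suc k) ^ c) ≤ errorOf c n i accept
    errorOf-accept-≥ n i k far with 2 ℕ.* i ℕ.<? n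
    ... | yes 2i<n = ^-monoˡ-≤ (fromℕ⁺ (suc k)) (distance n i (ℕₚ.<⇒≢ 2i<n)) 0≤c (distance-≥ n i (ℕₚ.<⇒≢ 2i<n) (suc k)
                       (ℕₚ.≤-trans (ℕₚ.m+n≤o⇒m≤o∸n (2 ℕ.* suc k) far)
                           (ℕₚ.≤-reflexive (≡.sym (ℕₚ.m≤n⇒∣m-n∣≡n∸m (ℕₚ.<⇒≤ 2i<n))))))
    ... | no  2i≮n = contradiction (ℕₚ.<-≤-trans (ℕₚ.m<n+m (2 ℕ.* i) {2 ℕ.* suc k} (ℕ.s≤s ℕ.z≤n)) far) 2i≮n

    errorOf-reject-≥ : ∀ n i k → 2 ℕ.* suc k ℕ.+ n ℕ.≤ 2 ℕ.* i → val (fromℕ⁺ (suc k) ^ c) ≤ errorOf c n i reject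
    errorOf-reject-≥ n i k far with n ℕ.<? 2 ℕ.* i
    ... | yes n<2i = ^-monoˡ-≤ (fromℕ⁺ (suc k)) (distance n i (≡.≢-sym (ℕₚ.<⇒≢ n<2i))) 0≤c
        (distance-≥ n i (≡.≢-sym (ℕₚ.<⇒≢ n<2i)) (suc k)
                       (ℕₚ.≤-trans (ℕₚ.m+n≤o⇒m≤o∸n (2 ℕ.* suc k) far)
                           (ℕₚ.≤-reflexive (≡.sym (ℕₚ.m≤n⇒∣n-m∣≡n∸m (ℕₚ.<⇒≤ n<2i))))))
    ... | no  n≮2i = contradiction (ℕₚ.<-≤-trans (ℕₚ.m<n+m n {2 ℕ.* suc k} (ℕ.s≤s ℕ.z≤n)) far) n≮2i

    -- The number of pairs is `a = suc k`, visibly positive. `4a≤n` makes the window fit around the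
    -- median, and `sparse` keeps `a` below `n / (640 d η)`, so that few answers change.
    module Bound {M : Model} {η : ℝ} (info : Information M η) (k n : ℕ) .{{_ : NonZero n}} (4a≤n : 4 ℕ.* suc k ℕ.≤ n)
                 (d : ℝ⁺) (sparse : fromℕ 16 * fromℕ 40 * (fromℕ (suc k) * (val d * η)) ≤ fromℕ n) where
      open Information info
      open Expectation (outcomes M)
      private
        P = permutations n
        half = halves n (suc k) 4a≤n
        V = val (fromℕ⁺ (suc k) ^ c)
        0≤V : 0# ≤ V
        0≤V = <⇒≤ (pos (fromℕ⁺ (suc k) ^ c))

      open Window n (suc k) (proj₁ half) ⌈ n /2⌉ (proj₁ (proj₂ half)) (ℕ.s≤s ℕ.z≤n) (proj₁ (proj₂ (proj₂ half)))
          (proj₂ (proj₂ (proj₂ half)))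

      errorOf-≥ : ∀ (i : Fin n) s → V * sum (λ j → δ′ (low j) i * accepted s + δ′ (high j) i * rejected s) ≤
          errorOf c n (suc (toℕ i)) s
      errorOf-≥ i accept = begin
        V * sum (λ j → δ′ (low j) i * 1# + δ′ (high j) i * 0#)
          ≈⟨ *-congˡ (sum-cong-≋ {suc k} {y = λ j → δ′ (low j) i}
              (λ j → trans (+-cong (*-identityʳ (δ′ (low j) i)) (zeroʳ (δ′ (high j) i))) (+-identityʳ _))) ⟩
        V * sum (λ j → δ′ (low j) i)
          ≲⟨ sum-δ≤ low-injective i V 0≤V (0≤errorOf n (suc (toℕ i)) accept)
               (λ { j ≡.refl → errorOf-accept-≥ n (suc (toℕ i)) k (low-rank j) }) ⟩
        errorOf c n (suc (toℕ i)) accept  ∎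
      errorOf-≥ i reject = begin
        V * sum (λ j → δ′ (low j) i * 0# + δ′ (high j) i * 1#)
          ≈⟨ *-congˡ (sum-cong-≋ {suc k} {y = λ j → δ′ (high j) i}
              (λ j → trans (+-cong (zeroʳ (δ′ (low j) i)) (*-identityʳ (δ′ (high j) i))) (+-identityˡ _))) ⟩
        V * sum (λ j → δ′ (high j) i)
          ≲⟨ sum-δ≤ high-injective i V 0≤V (0≤errorOf n (suc (toℕ i)) reject)
               (λ { j ≡.refl → errorOf-reject-≥ n (suc (toℕ i)) k (high-rank j) }) ⟩
        errorOf c n (suc (toℕ i)) reject  ∎

      -- An accepted element is charged only through `low` and a rejected one only through `high`;
      -- both are injective, so no element is charged more than `V`, which its error covers.
      weightedError-≥ : ∀ (π : Vec (Fin n) n) side →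
        V * sum (λ j → sum (λ x → δ′ (low j) (lookup π x) * accepted (side x) + δ′ (high j) (lookup π x) *
            rejected (side x))) ≤ weightedError c π side
      weightedError-≥ π side = begin
        V * sum (λ j → sum (λ x → e j x))    ≈⟨ *-congˡ (∑-comm e) ⟩
        V * sum (λ x → sum (λ j → e j x))    ≈⟨ *-distribˡ-sum V (λ x → sum (λ j → e j x)) ⟩
        sum (λ x → V * sum (λ j → e j x))    ≲⟨ sum-mono _ _ (λ x → errorOf-≥ (lookup π x) (side x)) ⟩
        weightedError c π side               ∎
        where
        e : Fin (suc k) → Fin n → ℝ
        e j x = δ′ (low j) (lookup π x) * accepted (side x) + δ′ (high j) (lookup π x) * rejected (side x)

      module _ {m : ℕ} (qs : Vec (Query n) m) (decide : Vec (Answer M) m → Fin n → Side)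
          (m≤dn : fromℕ m ≤ val d * fromℕ n) where
        open NonAdaptiveAlgorithm info qs decide

        errorGiven : Vec (Fin n) n → ℝ
        errorGiven π = expectAnswers M (answers π) (λ ys → weightedError c π (decide ys))

        errorGiven-≥ : ∀ π → V * sum (λ j → mistakes (low j) (high j) π) ≤ errorGiven π
        errorGiven-≥ π = begin
          V * sum (λ j → mistakes (low j) (high j) π)
            ≈⟨ *-congˡ (sum-cong-≋ {suc k} (λ j → sum-cong-≋ {n} (expand j))) ⟩
          V * sum (λ j → sum (λ x → 𝔼 ws (e j x)))
            ≈⟨ *-congˡ (sum-cong-≋ {suc k} (λ j → 𝔼-sum totals (e j))) ⟨
          V * sum (λ j → 𝔼 ws (λ ys → sum (λ x → e j x ys)))
            ≈⟨ *-congˡ (𝔼-sum totals (λ j ys → sum (λ x → e j x ys))) ⟨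
          V * 𝔼 ws (λ ys → sum (λ j → sum (λ x → e j x ys)))
            ≈⟨ 𝔼-* ws V _ ⟨
          𝔼 ws (λ ys → V * sum (λ j → sum (λ x → e j x ys)))
            ≲⟨ 𝔼-mono (weights-nonNeg info (answers π)) (λ ys → weightedError-≥ π (decide ys)) ⟩
          𝔼 ws (λ ys → weightedError c π (decide ys))
            ≈⟨ expectAnswers≈𝔼 info (answers π) _ ⟨
          errorGiven π  ∎
          where
          ws = weights info (answers π)
          totals = weights-total info (answers π)
          e : Fin (suc k) → Fin n → Vec (Answer M) m → ℝ
          e j x ys = δ′ (low j) (lookup π x) * accepted (decide ys x) + δ′ (high j) (lookup π x) * rejected
              (decide ys x)
          expand : ∀ j x → δ′ (low j) (lookup π x) * acc π x + δ′ (high j) (lookup π x) * rej π x ≈ 𝔼 ws (e j x)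
          expand j x = sym (trans
            (𝔼-+ ws (λ ys → δ′ (low j) (lookup π x) * accepted (decide ys x))
                (λ ys → δ′ (high j) (lookup π x) * rejected (decide ys x)))
            (+-cong (𝔼-* ws (δ′ (low j) (lookup π x)) (λ ys → accepted (decide ys x)))
                (𝔼-* ws (δ′ (high j) (lookup π x)) (λ ys → rejected (decide ys x)))))

        -- Each of the `a` pairs suffers at least `1/8` mistake on average, at a cost of at least
        -- `a ^ c` each.
        mean-error-≥ : val (fromℕ⁺ 8 ⁻¹) * (V * fromℕ (suc k)) ≤ mean P errorGiven
        mean-error-≥ = mean-≥ (identity∈permutations n) (begin
          p * (e * (V * A))
            ≈⟨ solve 4 (λ p e V A → p :* (e :* (V :* A)) := e :* (V :* (A :* p))) refl p e V A ⟩
          e * (V * (A * p))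
            ≈⟨ *-congˡ (*-congˡ (sum-const (suc k) p)) ⟨
          e * (V * sum {suc k} (λ _ → p))
            ≲⟨ *-monoˡ-≤ e 0≤e (*-monoˡ-≤ V 0≤V (sum-mono _ _ per-pair)) ⟩
          e * (V * sum (λ j → fromℕ 8 * sumOver P (mistakes (low j) (high j))))
            ≈⟨ *-congˡ (*-congˡ (trans (sym (*-distribˡ-sum (fromℕ 8) (λ j → sumOver P (mistakes (low j) (high j)))))
                 (*-congˡ (sym (∑ᴸ-sum-comm P (λ π j → mistakes (low j) (high j) π)))))) ⟩
          e * (V * (fromℕ 8 * sumOver P (λ π → sum (λ j → mistakes (low j) (high j) π))))
            ≈⟨ solve 4 (λ e V t s → e :* (V :* (t :* s)) := t :* e :* (V :* s)) refl e V (fromℕ 8) _ ⟩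
          fromℕ 8 * e * (V * sumOver P (λ π → sum (λ j → mistakes (low j) (high j) π)))
            ≈⟨ trans (*-congʳ (*-inverseʳ (fromℕ⁺ 8))) (*-identityˡ _) ⟩
          V * sumOver P (λ π → sum (λ j → mistakes (low j) (high j) π))
            ≈⟨ *-distribˡ-sumOver V P _ ⟩
          sumOver P (λ π → V * sum (λ j → mistakes (low j) (high j) π))
            ≲⟨ sumOver-mono (Allᴸ.universal errorGiven-≥ P) ⟩
          sumOver P errorGiven  ∎)
          where
          open Solver
          p = fromℕ (length P)
          e = val (fromℕ⁺ 8 ⁻¹)
          0≤e = <⇒≤ (pos (fromℕ⁺ 8 ⁻¹))
          A = fromℕ (suc k)
          per-pair : ∀ j → p ≤ fromℕ 8 * sumOver P (mistakes (low j) (high j))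
          per-pair j = many-mistakes 2≤n (low j) (high j) (5 ℕ.* suc k) (low<high j) (high<low+ j)
            (few-changes 2≤n (low j) (high j) (5 ℕ.* suc k) (low<high j) (high<low+ j) d (suc k) m≤dn ℕₚ.≤-refl sparse)

      -- The bound holds for every seed, hence for the convex combination.
      expectedError-≥ : ∀ (alg : Randomized (Answer M) n) → QueryComplexity≤ alg (val d * fromℕ n) →
        val (fromℕ⁺ 8 ⁻¹) * (V * fromℕ (suc k)) ≤ expectedError M c alg
      expectedError-≥ alg complexity = begin
        B                                          ≈⟨ *-identityˡ B ⟨
        1# * B                                     ≈⟨ *-congʳ (total alg) ⟨
        sum (probability alg) * B                  ≈⟨ *-distribʳ-sum B (probability alg) ⟩
        sum (λ s → probability alg s * B)
          ≲⟨ sum-mono _ _ (λ s → *-monoˡ-≤ (probability alg s) (nonNegative alg s)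
                                                        (mean-error-≥ (NonAdaptive.queries (run alg s))
                                                            (NonAdaptive.decide (run alg s)) (complexity s))) ⟩
        expectedError M c alg                      ∎
        where
        B = val (fromℕ⁺ 8 ⁻¹) * (V * fromℕ (suc k))

    -- With `a ≤ n / (S δ)` pairs, `640 ≤ S` yields `sparse`, and `4 ≤ S d₀` yields `4 a ≤ n` for
    -- all `δ ≥ d₀`. The second demand is how the constants come to depend on `d₀`.
    scale : ∀ (d₀ : ℝ⁺) → Σ[ S ∈ ℝ⁺ ] fromℕ 16 * fromℕ 40 ≤ val S × fromℕ 4 ≤ val S * val d₀
    scale d₀ with archimedean (fromℕ 4 * val (d₀ ⁻¹))
    ... | N , 4/d₀<N = fromℕ⁺ (suc (N ℕ.+ 16 ℕ.* 40))
      , ≤-trans (≤-reflexive (sym (fromℕ-* 16 40))) (fromℕ-mono-≤ (ℕₚ.≤-trans (ℕₚ.m≤n+m _ N) (ℕₚ.n≤1+n _)))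
      , (begin
        fromℕ 4                                  ≈⟨ *-identityʳ _ ⟨
        fromℕ 4 * 1#                             ≈⟨ *-congˡ (trans (*-comm _ _) (*-inverseʳ d₀)) ⟨
        fromℕ 4 * (val (d₀ ⁻¹) * val d₀)         ≈⟨ *-assoc _ _ _ ⟨
        fromℕ 4 * val (d₀ ⁻¹) * val d₀           ≲⟨ *-monoʳ-≤ (val d₀) (<⇒≤ (pos d₀)) (<⇒≤ 4/d₀<N) ⟩
        fromℕ N * val d₀
          ≲⟨ *-monoʳ-≤ (val d₀) (<⇒≤ (pos d₀)) (fromℕ-mono-≤ (ℕₚ.≤-trans (ℕₚ.m≤m+n N (16 ℕ.* 40)) (ℕₚ.n≤1+n _))) ⟩
        fromℕ (suc (N ℕ.+ 16 ℕ.* 40)) * val d₀   ∎)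

    module _ (d₀ S : ℝ⁺) (640≤S : fromℕ 16 * fromℕ 40 ≤ val S) (4≤Sd₀ : fromℕ 4 ≤ val S * val d₀) where

      -- The `1/8` is the mean number of mistakes per pair, and the power of `1/(2S)` comes from
      -- `a ≥ n / (2Sδ)`. `K = 2S` ensures `n / (S δ) ≥ 2`.
      C K : ℝ⁺
      C = (fromℕ⁺ 8 ⁻¹) *⁺ (S ⁻¹ *⁺ ½) ^ (c + 1#)
      K = fromℕ⁺ 2 *⁺ S

      -- The number `a` of pairs is the integer part of `Y = n / (S δ)`; the product of `a` pairs
      -- and weight `a ^ c` gives the exponent `c + 1`.
      errorBound : ∀ {M η} → Information M η → ∀ d δ → val d * η ≈ val δ → val d₀ ≤ val δ → ErrorBound c M C K d δ
      errorBound {M} {η} info d δ dη≈δ d₀≤δ n Kδ≤n alg complexity too-small =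
        -- The goal is itself a negation; with its refutation `too-small` at hand the doubly negated
        -- integer part may be used.
        floor (<⇒≤ (pos Y)) λ { (a , a≤Y , Y≤1+a) → with-floor a a≤Y Y≤1+a too-small }
        where
        open Solver
        N = fromℕ⁺ n
        X = N /⁺ δ
        Y = X *⁺ S ⁻¹
        N≈n : val N ≈ fromℕ n
        N≈n = val-fromℕ⁺ n
        0≤δ = <⇒≤ (pos δ)
        0≤S = <⇒≤ (pos S)
        Y-spec : val S * (val Y * val δ) ≈ fromℕ n
        Y-spec = begin-equality
          val S * (val N * val (δ ⁻¹) * val (S ⁻¹) * val δ)
            ≈⟨ solve 5 (λ s n δ⁻ s⁻ δ → s :* (n :* δ⁻ :* s⁻ :* δ) := n :* (δ :* δ⁻) :* (s :* s⁻)) refl (val S)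
                (val N) (val (δ ⁻¹)) (val (S ⁻¹)) (val δ) ⟩
          val N * (val δ * val (δ ⁻¹)) * (val S * val (S ⁻¹))
            ≈⟨ *-cong (*-congˡ (*-inverseʳ δ)) (*-inverseʳ S) ⟩
          val N * 1# * 1#
            ≈⟨ trans (*-identityʳ _) (*-identityʳ _) ⟩
          val N
            ≈⟨ N≈n ⟩
          fromℕ n  ∎
        2≤Y : fromℕ 2 ≤ val Y
        2≤Y = *-cancelˡ-≤ (S *⁺ δ) (begin
          val S * val δ * fromℕ 2
            ≈⟨ solve 3 (λ s δ t → s :* δ :* t := t :* s :* δ) refl (val S) (val δ) (fromℕ 2) ⟩
          fromℕ 2 * val S * val δ      ≲⟨ Kδ≤n ⟩
          fromℕ n                      ≈⟨ Y-spec ⟨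
          val S * (val Y * val δ)
            ≈⟨ solve 3 (λ s y δ → s :* (y :* δ) := s :* δ :* y) refl (val S) (val Y) (val δ) ⟩
          val S * val δ * val Y        ∎)
        with-floor : ∀ a → fromℕ a ≤ val Y → val Y ≤ fromℕ (suc a) → val C * val (X ^ (c + 1#)) ≤ expectedError M c alg
        -- `floor` bounds `Y` only weakly from above, so `1 ≤ Y` would not exclude `a = 0`, whereas
        -- `2 ≤ Y` does.
        with-floor zero    a≤Y Y≤1+a = contradiction (fromℕ-cancel-≤ {2} {1} (≤-trans 2≤Y Y≤1+a)) λ { (ℕ.s≤s ()) }
        with-floor (suc k) a≤Y Y≤1+a = begin
          e * val ((S ⁻¹ *⁺ ½) ^ (c + 1#)) * val (X ^ (c + 1#))
            ≈⟨ solve 3 (λ e p q → e :* p :* q := e :* (q :* p)) refl e _ _ ⟩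
          e * (val (X ^ (c + 1#)) * val ((S ⁻¹ *⁺ ½) ^ (c + 1#)))
            ≈⟨ *-congˡ (^-distrib-* X (S ⁻¹ *⁺ ½) (c + 1#)) ⟨
          e * val ((X *⁺ (S ⁻¹ *⁺ ½)) ^ (c + 1#))
            ≲⟨ *-monoˡ-≤ e (<⇒≤ (pos (fromℕ⁺ 8 ⁻¹)))
                (^-monoˡ-≤ _ (fromℕ⁺ (suc k)) (≤-trans 0≤c (x≤x+y (<⇒≤ 0<1))) Y/2≤a) ⟩
          e * val (fromℕ⁺ (suc k) ^ (c + 1#))
            ≈⟨ *-congˡ (trans (^-homo-+ (fromℕ⁺ (suc k)) c 1#) (*-congˡ (^-identityʳ (fromℕ⁺ (suc k))))) ⟩
          e * (val (fromℕ⁺ (suc k) ^ c) * fromℕ (suc k))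
            ≲⟨ Bound.expectedError-≥ info k n 4a≤n d sparse alg complexity ⟩
          expectedError M c alg  ∎
          where
          e = val (fromℕ⁺ 8 ⁻¹)
          A = fromℕ (suc k)
          Saδ≤n : val S * (A * val δ) ≤ fromℕ n
          Saδ≤n = ≤-trans (*-monoˡ-≤ (val S) 0≤S (*-monoʳ-≤ (val δ) 0≤δ a≤Y)) (≤-reflexive Y-spec)
          sparse : fromℕ 16 * fromℕ 40 * (A * (val d * η)) ≤ fromℕ n
          sparse = begin
            fromℕ 16 * fromℕ 40 * (A * (val d * η))  ≈⟨ *-congˡ (*-congˡ dη≈δ) ⟩
            fromℕ 16 * fromℕ 40 * (A * val δ)        ≲⟨ *-monoʳ-≤ _ (*-nonNeg (0≤fromℕ (suc k)) 0≤δ) 640≤S ⟩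
            val S * (A * val δ)                      ≲⟨ Saδ≤n ⟩
            fromℕ n                                  ∎
          -- `4a ≤ S d₀ a ≤ S δ a ≤ n`: the lower bound `d₀` on the effective density keeps the
          -- window inside the `n` ranks.
          4a≤n : 4 ℕ.* suc k ℕ.≤ n
          4a≤n = fromℕ-cancel-≤ (begin
            fromℕ (4 ℕ.* suc k)      ≈⟨ fromℕ-* 4 (suc k) ⟩
            fromℕ 4 * A              ≲⟨ *-monoʳ-≤ A (0≤fromℕ (suc k)) 4≤Sd₀ ⟩
            val S * val d₀ * A       ≲⟨ *-monoʳ-≤ A (0≤fromℕ (suc k)) (*-monoˡ-≤ (val S) 0≤S d₀≤δ) ⟩
            val S * val δ * A        ≈⟨ solve 3 (λ s δ a → s :* δ :* a := s :* (a :* δ)) refl (val S) (val δ) A ⟩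
            val S * (A * val δ)      ≲⟨ Saδ≤n ⟩
            fromℕ n                  ∎)
          -- `Y ≤ a + 1 ≤ 2a` because `a ≥ 1`; rounding down costs the factor `½` inside `C`.
          Y/2≤a : val (X *⁺ (S ⁻¹ *⁺ ½)) ≤ A
          Y/2≤a = begin
            val X * (val (S ⁻¹) * val ½)            ≈⟨ *-assoc _ _ _ ⟨
            val Y * val ½                           ≲⟨ *-monoʳ-≤ (val ½) (<⇒≤ (pos ½)) Y≤1+a ⟩
            fromℕ (suc (suc k)) * val ½
              ≲⟨ *-monoʳ-≤ (val ½) (<⇒≤ (pos ½)) (fromℕ-mono-≤ (ℕ.s≤s (ℕₚ.m≤n+m (suc k) k))) ⟩
            fromℕ (suc k ℕ.+ suc k) * val ½         ≈⟨ *-congʳ (fromℕ-+ (suc k) (suc k)) ⟩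
            (A + A) * val ½
              ≈⟨ solve 2 (λ a h → (a :+ a) :* h := con 2 :* h :* a) refl A (val ½) ⟩
            fromℕ 2 * val ½ * A                     ≈⟨ trans (*-congʳ (*-inverseʳ (fromℕ⁺ 2))) (*-identityˡ A) ⟩
            A                                       ∎

theorem4 : ∀ {a ℓ₁ ℓ₂ : Level} (R : Reals a ℓ₁ ℓ₂) →
    let open Reals R
        open Partition R
    in
    ∀ (c : ℝ) → 0# ≤ c → ∀ (d₀ : ℝ⁺) →
      (Σ[ C ∈ ℝ⁺ ] Σ[ K ∈ ℝ⁺ ] (∀ (d : ℝ⁺) → val d₀ ≤ val d →
        ErrorBound c noiseless C K d d))
      ×
      (Σ[ C ∈ ℝ⁺ ] Σ[ K ∈ ℝ⁺ ] (∀ (d γ : ℝ⁺) → val γ ≤ 1# → val d₀ ≤ val (d *⁺ γ) →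
        ErrorBound c (erasure (val γ)) C K d (d *⁺ γ)))
      ×
      (Σ[ C ∈ ℝ⁺ ] Σ[ K ∈ ℝ⁺ ] (∀ (d γ : ℝ⁺) → val γ ≤ 1# → val d₀ ≤ val (d *⁺ (γ *⁺ γ)) →
        ErrorBound c (noisy (val γ)) C K d (d *⁺ (γ *⁺ γ))))
theorem4 R c 0≤c d₀ =
    -- The same two constants serve all models, since they depend only on `c` and `d₀`; in the
    -- noiseless case `η = 1`, so the effective density is `d` itself.
    (constant , threshold , λ d → bound noiseless-information d d (*-identityʳ _))
  , (constant , threshold , λ d γ γ≤1 → bound (erasure-information γ γ≤1) d (d *⁺ γ) refl)
  , (constant , threshold , λ d γ γ≤1 → bound (noisy-information γ γ≤1) d (d *⁺ (γ *⁺ γ)) refl)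
  where
  open Reals R
  open RealProperties R
  open TwoPoint R
  open LowerBound R
  scaling   = scale 0≤c d₀
  constant  = C 0≤c d₀ (proj₁ scaling) (proj₁ (proj₂ scaling)) (proj₂ (proj₂ scaling))
  threshold = K 0≤c d₀ (proj₁ scaling) (proj₁ (proj₂ scaling)) (proj₂ (proj₂ scaling))
  bound : ∀ {M η} → Information M η → ∀ d δ → val d * η ≈ val δ → val d₀ ≤ val δ →
    Partition.ErrorBound R c M constant threshold d δ
  bound = errorBound 0≤c d₀ (proj₁ scaling) (proj₁ (proj₂ scaling)) (proj₂ (proj₂ scaling))
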